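{- The time-improved algorithm (described in the context), run on input $N$, computes the values $\Vert n\Vert$ for all $1\le n\le N$ in time $O(N^{1.230175})$ and space $O(N\log\log N)$.
   Context: For a positive integer $n$, the complexity $\Vert n\Vert$ is the least number of $1$'s needed to express $n$ using only $+$, $\times$ and parentheses. Thus $\Vert 1\Vert=1$ and for $n\ge2$, $\Vert n\Vert$ is the minimum of $\Vert a\Vert+\Vert b\Vert$ over positive integers $a,b<n$ with $a+b=n$ or $ab=n$. Time is the number of elementary operations (arithmetic operations and comparisons on integers, reads and writes of array entries); space is measured in bits. The function $E$: $E(0)=1$, $E(1)=1$, and for $j\ge1$: $E(3j)=3^j$, $E(3j+1)=4\cdot3^{j-1}$, $E(3j-1)=2\cdot3^{j-1}$. It is computed by: if $n=0$ return $1$; otherwise start with result $=1$ and, while $n>4$, multiply result by $3$ and replace $n$ by $n-3$; return result times $n$. Time-improved algorithm, with input $N$. An array $\mathrm{Compl}[1..N]$ is initialized with all entries equal to $\lfloor 3\log N/\log 2\rfloor+1$, except $\mathrm{Compl}[1]=1$. Then for $n=2,3,\dots,N$ in increasing order: (1) replace $\mathrm{Compl}[n]$ by $\min(\mathrm{Compl}[n],\mathrm{Compl}[n-1]+1)$; (2) compute $\mathrm{kMax}$: put $T=\mathrm{Compl}[n-1]$, $t=\lfloor T/2\rfloor$; while $E(t)+E(T-t)<n$, replace $t$ by $t-1$; when the loop stops put $\mathrm{kMax}=E(t)$; (3) for each integer $m$ with $6\le m\le \mathrm{kMax}$, replace $\mathrm{Compl}[n]$ by $\min(\mathrm{Compl}[n],\mathrm{Compl}[m]+\mathrm{Compl}[n-m])$;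 (4) for each integer $k$ with $2\le k\le\min(n,\lfloor N/n\rfloor)$, replace $\mathrm{Compl}[kn]$ by $\min(\mathrm{Compl}[kn],\mathrm{Compl}[k]+\mathrm{Compl}[n])$. The output is the array $\mathrm{Compl}$; that the algorithm computes the complexities means that at the end $\mathrm{Compl}[n]=\Vert n\Vert$ for all $1\le n\le N$. -}

module Defs where

import Data.Fin as Fin
open import Data.Fin.Base using (Fin; toℕ)
open import Data.Fin.Properties using (toℕ-injective)
open import Data.Nat.Base
open import Data.Nat.DivMod using (_/_)
open import Data.Nat.Logarithm using (⌊log₂_⌋)
open import Data.Nat.Properties using (suc-injective)
open import Data.Product.Base using (_×_; _,_; ∃; ∃-syntax)
open import Data.Vec.Base as Vec using (Vec; lookup; replicate; foldr′; _[_]≔_)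
open import Relation.Binary.PropositionalEquality.Core using (_≡_; refl; sym; trans)
open import Relation.Nullary.Negation.Core using (¬_; contradiction)

------------------------------------------------------------------------
-- Integer complexity

infixl 6 _⊞_
infixl 7 _⊠_

data Expression : Set where
  one     : Expression
  _⊞_ _⊠_ : Expression → Expression → Expression

value : Expression → ℕ
value one     = 1
value (a ⊞ b) = value a + value b
value (a ⊠ b) = value a * value b

ones : Expression → ℕ
ones one     = 1
ones (a ⊞ b) = ones a + ones b
ones (a ⊠ b) = ones a + ones b

‖_‖≡_ : ℕ → ℕ → Set
‖ n ‖≡ c = (∃[ e ] value e ≡ n × ones e ≡ c)
         × (∀ e → value e ≡ n → c ≤ ones e)

------------------------------------------------------------------------
-- A register machine with one array
--
-- Every assignment, array write and test performs one elementary
-- operation, so no intermediate result escapes the space count.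

#registers : ℕ
#registers = 15

Reg : Set
Reg = Fin #registers

infix 9 $_ #_

data Operand : Set where
  $_ : Reg → Operand
  #_ : ℕ → Operand

infix 8 _⊕_ _⊖_ _⊗_ _⊘_

data Rhs : Set where
  copy            : Operand → Rhs
  _⊕_ _⊖_ _⊗_ _⊘_ : Operand → Operand → Rhs
  Compl[_]        : Operand → Rhs

infix 8 _≺_ _≼_

data Test : Set where
  _≺_ _≼_ : Operand → Operand → Test

infixr 4 _⨟_
infix  5 _≔_ Compl[_]≔_ while_loop_ if_then_

data Cmd : Set where
  _≔_         : Reg → Rhs → Cmd
  Compl[_]≔_  : Operand → Operand → Cmd
  _⨟_         : Cmd → Cmd → Cmd
  while_loop_ : Test → Cmd → Cmd
  if_then_    : Test → Cmd → Cmd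

-- The array is indexed by 1..N: its entry with index i is stored at
-- position i - 1 of the vector.

record State (N : ℕ) : Set where
  constructor state
  field
    registers : Vec ℕ #registers
    compl     : Vec ℕ N

open State public

bits : ℕ → ℕ
bits v = suc ⌊log₂ v ⌋

maximum : ∀ {n} → Vec ℕ n → ℕ
maximum = foldr′ _⊔_ 0

-- All array entries have the same width, that of the largest of them.

space : ∀ {N} → State N → ℕ
space {N} σ = Vec.sum (Vec.map bits (registers σ)) + N * maximum (Vec.map bits (compl σ))

⟦_⟧ : Operand → ∀ {N} → State N → ℕ
⟦ $ r ⟧ σ = lookup (registers σ) r
⟦ # v ⟧ σ = v

-- Partial: there is no negative result, no division by zero and no
-- access outside the array.  Hence, in any execution that exists, natural
-- number operations agree with those on integers.

infix 3 _⊢_⇓_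

data _⊢_⇓_ {N : ℕ} (σ : State N) : Rhs → ℕ → Set where
  copy : ∀ {a} → σ ⊢ copy a ⇓ ⟦ a ⟧ σ
  add  : ∀ {a b} → σ ⊢ a ⊕ b ⇓ ⟦ a ⟧ σ + ⟦ b ⟧ σ
  sub  : ∀ {a b} → ⟦ b ⟧ σ ≤ ⟦ a ⟧ σ → σ ⊢ a ⊖ b ⇓ ⟦ a ⟧ σ ∸ ⟦ b ⟧ σ
  mul  : ∀ {a b} → σ ⊢ a ⊗ b ⇓ ⟦ a ⟧ σ * ⟦ b ⟧ σ
  quot : ∀ {a b d} → ⟦ b ⟧ σ ≡ suc d → σ ⊢ a ⊘ b ⇓ ⟦ a ⟧ σ / suc d
  read : ∀ {a} {i : Fin N} → ⟦ a ⟧ σ ≡ suc (toℕ i) → σ ⊢ Compl[ a ] ⇓ lookup (compl σ) i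

Holds : ∀ {N} → State N → Test → Set
Holds σ (a ≺ b) = ⟦ a ⟧ σ < ⟦ b ⟧ σ
Holds σ (a ≼ b) = ⟦ a ⟧ σ ≤ ⟦ b ⟧ σ

setReg : ∀ {N} → Reg → ℕ → State N → State N
setReg r v σ = state (registers σ [ r ]≔ v) (compl σ)

setCompl : ∀ {N} → Fin N → ℕ → State N → State N
setCompl i v σ = state (registers σ) (compl σ [ i ]≔ v)

-- ⟨ c , σ ⟩⇓⟨ σ′ , τ , s ⟩: command c, started in σ, halts in σ′ after τ
-- elementary operations, and s is the largest space over all states
-- passed through.

infix 3 ⟨_,_⟩⇓⟨_,_,_⟩

data ⟨_,_⟩⇓⟨_,_,_⟩ {N : ℕ} : Cmd → State N → State N → ℕ → ℕ → Set where

  assign : ∀ {r e v σ} → σ ⊢ e ⇓ v →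
           ⟨ r ≔ e , σ ⟩⇓⟨ setReg r v σ , 1 , space σ ⊔ space (setReg r v σ) ⟩

  write  : ∀ {a b σ} {i : Fin N} → ⟦ a ⟧ σ ≡ suc (toℕ i) →
           let σ′ = setCompl i (⟦ b ⟧ σ) σ in
           ⟨ Compl[ a ]≔ b , σ ⟩⇓⟨ σ′ , 1 , space σ ⊔ space σ′ ⟩

  seq    : ∀ {c₁ c₂ σ σ₁ σ₂ τ₁ τ₂ s₁ s₂} →
           ⟨ c₁ , σ ⟩⇓⟨ σ₁ , τ₁ , s₁ ⟩ → ⟨ c₂ , σ₁ ⟩⇓⟨ σ₂ , τ₂ , s₂ ⟩ →
           ⟨ c₁ ⨟ c₂ , σ ⟩⇓⟨ σ₂ , τ₁ + τ₂ , s₁ ⊔ s₂ ⟩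

  stop   : ∀ {b c σ} → ¬ Holds σ b →
           ⟨ while b loop c , σ ⟩⇓⟨ σ , 1 , space σ ⟩

  loop   : ∀ {b c σ σ₁ σ₂ τ₁ τ₂ s₁ s₂} → Holds σ b →
           ⟨ c , σ ⟩⇓⟨ σ₁ , τ₁ , s₁ ⟩ → ⟨ while b loop c , σ₁ ⟩⇓⟨ σ₂ , τ₂ , s₂ ⟩ →
           ⟨ while b loop c , σ ⟩⇓⟨ σ₂ , 1 + (τ₁ + τ₂) , s₁ ⊔ s₂ ⟩

  skip   : ∀ {b c σ} → ¬ Holds σ b →
           ⟨ if b then c , σ ⟩⇓⟨ σ , 1 , space σ ⟩

  enter  : ∀ {b c σ σ′ τ s} → Holds σ b →
           ⟨ c , σ ⟩⇓⟨ σ′ , τ , s ⟩ →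
           ⟨ if b then c , σ ⟩⇓⟨ σ′ , 1 + τ , s ⟩

⇓-value-deterministic : ∀ {N} {σ : State N} {e v w} → σ ⊢ e ⇓ v → σ ⊢ e ⇓ w → v ≡ w
⇓-value-deterministic copy     copy     = refl
⇓-value-deterministic add      add      = refl
⇓-value-deterministic (sub _)  (sub _)  = refl
⇓-value-deterministic mul      mul      = refl
⇓-value-deterministic (quot p) (quot q) with refl ← trans (sym p) q = refl
⇓-value-deterministic (read p) (read q)
  with refl ← toℕ-injective (suc-injective (trans (sym p) q)) = refl

⇓-deterministic : ∀ {N} {c} {σ σ₁ σ₂ : State N} {τ₁ τ₂ s₁ s₂} →
                  ⟨ c , σ ⟩⇓⟨ σ₁ , τ₁ , s₁ ⟩ → ⟨ c , σ ⟩⇓⟨ σ₂ , τ₂ , s₂ ⟩ →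
                  (σ₁ , τ₁ , s₁) ≡ (σ₂ , τ₂ , s₂)
⇓-deterministic (assign p) (assign q) with refl ← ⇓-value-deterministic p q = refl
⇓-deterministic (write p) (write q)
  with refl ← toℕ-injective (suc-injective (trans (sym p) q)) = refl
⇓-deterministic (seq p p′) (seq q q′)
  with refl ← ⇓-deterministic p q with refl ← ⇓-deterministic p′ q′ = refl
⇓-deterministic (stop _) (stop _) = refl
⇓-deterministic (stop ¬h) (loop h _ _) = contradiction h ¬h
⇓-deterministic (loop h _ _) (stop ¬h) = contradiction h ¬h
⇓-deterministic (loop _ p p′) (loop _ q q′)
  with refl ← ⇓-deterministic p q with refl ← ⇓-deterministic p′ q′ = refl
⇓-deterministic (skip _) (skip _) = refl
⇓-deterministic (skip ¬h) (enter h _) = contradiction h ¬h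
⇓-deterministic (enter h _) (skip ¬h) = contradiction h ¬h
⇓-deterministic (enter _ p) (enter _ q) with refl ← ⇓-deterministic p q = refl

------------------------------------------------------------------------
-- The time-improved algorithm

N n m k T t u kMax kTop E₁ E₂ arg new old bound : Reg
N     = Fin.# 0
n     = Fin.# 1
m     = Fin.# 2
k     = Fin.# 3
T     = Fin.# 4
t     = Fin.# 5
u     = Fin.# 6
kMax  = Fin.# 7
kTop  = Fin.# 8
E₁    = Fin.# 9
E₂    = Fin.# 10
arg   = Fin.# 11
new   = Fin.# 12
old   = Fin.# 13
bound = Fin.# 14

-- r := E(a)

_≔E_ : Reg → Reg → Cmd
r ≔E a =
  r ≔ copy (# 1) ⨟
  arg ≔ copy ($ a) ⨟
  if # 0 ≺ $ arg then (
    while # 4 ≺ $ arg loop (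
      r ≔ $ r ⊗ # 3 ⨟
      arg ≔ $ arg ⊖ # 3) ⨟
    r ≔ $ r ⊗ $ arg)

-- Compl[i] := min(Compl[i], new)

improve : Reg → Cmd
improve i =
  old ≔ Compl[ $ i ] ⨟
  if $ new ≺ $ old then Compl[ $ i ]≔ $ new

-- ⌊3 log N / log 2⌋ = ⌊log₂ N³⌋ is the number of times that N³ can be
-- halved before it reaches 1.

initialise : Cmd
initialise =
  m ≔ $ N ⊗ $ N ⨟
  m ≔ $ m ⊗ $ N ⨟
  bound ≔ copy (# 1) ⨟
  while # 1 ≺ $ m loop (
    m ≔ $ m ⊘ # 2 ⨟
    bound ≔ $ bound ⊕ # 1) ⨟
  n ≔ copy (# 1) ⨟
  while $ n ≼ $ N loop (
    Compl[ $ n ]≔ $ bound ⨟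
    n ≔ $ n ⊕ # 1) ⨟
  Compl[ # 1 ]≔ # 1

step₁ : Cmd
step₁ =
  m ≔ $ n ⊖ # 1 ⨟
  new ≔ Compl[ $ m ] ⨟
  new ≔ $ new ⊕ # 1 ⨟
  improve n

-- new := E(t) + E(T - t)

evaluateBound : Cmd
evaluateBound =
  u ≔ $ T ⊖ $ t ⨟
  E₁ ≔E t ⨟
  E₂ ≔E u ⨟
  new ≔ $ E₁ ⊕ $ E₂

step₂ : Cmd
step₂ =
  m ≔ $ n ⊖ # 1 ⨟
  T ≔ Compl[ $ m ] ⨟
  t ≔ $ T ⊘ # 2 ⨟
  evaluateBound ⨟
  while $ new ≺ $ n loop (
    t ≔ $ t ⊖ # 1 ⨟
    evaluateBound) ⨟
  kMax ≔E t

step₃ : Cmd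
step₃ =
  m ≔ copy (# 6) ⨟
  while $ m ≼ $ kMax loop (
    u ≔ $ n ⊖ $ m ⨟
    new ≔ Compl[ $ m ] ⨟
    old ≔ Compl[ $ u ] ⨟
    new ≔ $ new ⊕ $ old ⨟
    improve n ⨟
    m ≔ $ m ⊕ # 1)

-- kTop = min(n, ⌊N / n⌋)

step₄ : Cmd
step₄ =
  kTop ≔ $ N ⊘ $ n ⨟
  if $ n ≺ $ kTop then (kTop ≔ copy ($ n)) ⨟
  k ≔ copy (# 2) ⨟
  while $ k ≼ $ kTop loop (
    m ≔ $ k ⊗ $ n ⨟
    new ≔ Compl[ $ k ] ⨟
    old ≔ Compl[ $ n ] ⨟
    new ≔ $ new ⊕ $ old ⨟
    improve m ⨟
    k ≔ $ k ⊕ # 1)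

timeImproved : Cmd
timeImproved =
  initialise ⨟
  n ≔ copy (# 2) ⨟
  while $ n ≼ $ N loop (
    step₁ ⨟
    step₂ ⨟
    step₃ ⨟
    step₄ ⨟
    n ≔ $ n ⊕ # 1)

input : (M : ℕ) → State M
input M = state (replicate #registers 0 [ N ]≔ M) (replicate M 0)

-- By ⇓-deterministic, output, time and peakSpace are determined by M.

record Run (M : ℕ) : Set where
  field
    output    : State M
    time      : ℕ
    peakSpace : ℕ
    execution : ⟨ timeImproved , input M ⟩⇓⟨ output , time , peakSpace ⟩

  entry : Fin M → ℕ
  entry i = lookup (compl output) i

open Run public

------------------------------------------------------------------------
-- Growth of functions on the positive integers

infix 4 _∈O[_] _∈O[N^_/_]

_∈O[_] : ((M : ℕ) → .{{NonZero M}} → ℕ) → (ℕ → ℕ) → Set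
f ∈O[ g ] = ∃[ C ] ∃[ M₀ ] ∀ M .{{_ : NonZero M}} → M₀ ≤ M → f M ≤ C * g M

-- f M ≤ C · M ^ (p / q), raised to the power q.

_∈O[N^_/_] : ((M : ℕ) → .{{NonZero M}} → ℕ) → (p q : ℕ) → .{{NonZero q}} → Set
f ∈O[N^ p / q ] = ∃[ C ] ∃[ M₀ ] ∀ M .{{_ : NonZero M}} → M₀ ≤ M → f M ^ q ≤ C ^ q * M ^ p

-- Rounding down changes M log log M by at most a bounded factor, for
-- M ≥ 4.

MloglogM : ℕ → ℕ
MloglogM M = M * ⌊log₂ ⌊log₂ M ⌋ ⌋

module Submission where

-- Correctness.  The array always dominates ‖·‖ and is exact below n.  If
-- ‖n‖ ≤ T = ‖n-1‖ and n = a + b is optimal with ‖a‖ ≤ ‖b‖, then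
-- n ≤ E(‖a‖) + E(T-‖a‖) and 2‖a‖ ≤ T, so ‖a‖ is at most the t at which step
-- (2) stops, and a ≤ E(‖a‖) ≤ kMax.
--
-- Time.  All parts except step (3) cost O(N log² N).  Since E(s) E(t) ≤ E(s+t),
-- kMax is O(φ(n-1)) for φ(n) = 3^(‖n‖/3) / n.  From ‖2q+r‖ ≤ 2+r+‖q‖ and
-- ‖3q+r‖ ≤ 3+r+‖q‖ for r ≤ 1, choosing the divisor 2 or 3 according to n mod 36,
-- the sums of φ over the residue classes mod 36 satisfy a linear recursion,
-- of which a vector of constants times X^(11/9) is a supersolution, and
-- 11/9 < 1.230175.

open import Defs hiding (N; n; m; k; T; t; u; kMax; kTop; E₁; E₂; arg; new; old; bound)
open import Algebra.Properties.CommutativeSemigroup using (interchange)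
open import Data.Fin.Base as Fin using (Fin; toℕ; fromℕ<)
open import Data.Fin.Properties using (toℕ-fromℕ<; toℕ-injective; toℕ<n) renaming (_≟_ to _≟ᶠ_)
open import Data.List.Base using (List; []; _∷_; _++_; cartesianProductWith; filter)
open import Data.List.Extrema.Nat using (argmin; argmin-all; f[argmin]≤f[⊤]; f[argmin]≤f[xs])
open import Data.List.Membership.Propositional using (_∈_)
open import Data.List.Membership.Propositional.Properties using (∈-++⁺ˡ; ∈-++⁺ʳ; ∈-cartesianProductWith⁺; ∈-filter⁺)
open import Data.List.Relation.Unary.All as All using (All)
open import Data.List.Relation.Unary.All.Properties using (all-filter)
open import Data.List.Relation.Unary.Any using (here; there)
open import Data.Nat.Base
open import Data.Nat.DivMod
open import Data.Nat.Induction using (<-rec)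
open import Data.Nat.Logarithm
open import Data.Nat.Properties
open import Data.Nat.Tactic.RingSolver using (solve-∀)
open import Data.Product.Base using (Σ-syntax; ∃-syntax; _×_; _,_; proj₁; proj₂)
open import Data.Sum.Base using (_⊎_; inj₁; inj₂; [_,_]′)
open import Data.Unit.Base using (tt)
open import Data.Vec.Base as Vec using (Vec; []; _∷_; lookup; _[_]≔_)
open import Data.Vec.Properties using (lookup∘update; lookup∘update′; lookup-replicate)
open import Relation.Binary.PropositionalEquality
open import Relation.Nullary using (Dec; ¬_; yes; no; contradiction; from-yes; _→-dec_; _×-dec_)

-- Integer complexity and the function E

-- Pointwise bounds are too weak for step (3): ‖n‖ ≤ 3 log₂ n only yields φ(n) ≤ n^(log₂ 3 - 1),
-- about n^0.585, so the cost has to be bounded on average. Neither base alone reaches the exponent: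
-- halving throughout gives log₂(3^(2/3)/2 + 3/2), about 1.345, and base 3 with digits 0, 1, 2 gives
-- about 1.374. Hence the divisor depends on the residue, and the expensive ternary digit 2 is
-- avoided altogether. The modulus has to be divisible by 2 and 3 for the system to close up: the
-- quotients by d of a class mod 36 form a class mod 36/d, which is a union of d classes mod 36. The
-- growth exponent of the resulting system lies below 11/9, and this slack pays for all rounding. No
-- real numbers occur: roots are integer roots, inequalities between powers are proved after raising
-- to the third or ninth power, and the rational constants have the common denominator `D`.

^-distribʳ-* : ∀ k m n → (m * n) ^ k ≡ m ^ k * n ^ k
^-distribʳ-* zero    m n = refl
^-distribʳ-* (suc k) m n = trans (cong (m * n *_) (^-distribʳ-* k m n)) ([m*n]*[o*p]≡[m*o]*[n*p] m n (m ^ k) (n ^ k))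

^-cancelˡ-≤ : ∀ k .{{_ : NonZero k}} {m n} → m ^ k ≤ n ^ k → m ≤ n
^-cancelˡ-≤ k m^k≤n^k = ≮⇒≥ λ n<m → <⇒≱ (^-monoˡ-< k n<m) m^k≤n^k

-- All expressions of height at most d. The number of ones bounds the height, so every expression
-- with at most d ones is in this finite list and a minimum can be taken over it.
expressions : ℕ → List Expression
expressions zero    = []
expressions (suc d) = one ∷ cartesianProductWith _⊞_ (expressions d) (expressions d)
                          ++ cartesianProductWith _⊠_ (expressions d) (expressions d)

1≤ones : ∀ e → 1 ≤ ones e
1≤ones one     = ≤-refl
1≤ones (a ⊞ b) = m≤n⇒m≤n+o (ones b) (1≤ones a)
1≤ones (a ⊠ b) = m≤n⇒m≤n+o (ones b) (1≤ones a)

1≤value : ∀ e → 1 ≤ value e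
1≤value one     = ≤-refl
1≤value (a ⊞ b) = m≤n⇒m≤n+o (value b) (1≤value a)
1≤value (a ⊠ b) = *-mono-≤ (1≤value a) (1≤value b)

m+n≤1+o⇒m≤o : ∀ {m n o} → 1 ≤ n → m + n ≤ suc o → m ≤ o
m+n≤1+o⇒m≤o {m} 1≤n le = s≤s⁻¹ (≤-trans (≤-trans (≤-reflexive (+-comm 1 m)) (+-monoʳ-≤ m 1≤n)) le)

m+n≤1+o⇒n≤o : ∀ {m n o} → 1 ≤ m → m + n ≤ suc o → n ≤ o
m+n≤1+o⇒n≤o {m} {n} 1≤m le = m+n≤1+o⇒m≤o 1≤m (≤-trans (≤-reflexive (+-comm n m)) le)

∈-expressions : ∀ e {d} → ones e ≤ d → e ∈ expressions d
∈-expressions one     {suc d} _  = here refl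
∈-expressions (a ⊞ b) {zero}  le = contradiction (≤-trans (1≤ones (a ⊞ b)) le) λ ()
∈-expressions (a ⊞ b) {suc d} le = there (∈-++⁺ˡ (∈-cartesianProductWith⁺ _⊞_
  (∈-expressions a (m+n≤1+o⇒m≤o (1≤ones b) le))
  (∈-expressions b (m+n≤1+o⇒n≤o (1≤ones a) le))))
∈-expressions (a ⊠ b) {zero}  le = contradiction (≤-trans (1≤ones (a ⊠ b)) le) λ ()
∈-expressions (a ⊠ b) {suc d} le = there (∈-++⁺ʳ
  (cartesianProductWith _⊞_ (expressions d) (expressions d)) (∈-cartesianProductWith⁺ _⊠_
  (∈-expressions a (m+n≤1+o⇒m≤o (1≤ones b) le))
  (∈-expressions b (m+n≤1+o⇒n≤o (1≤ones a) le))))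

unary : ℕ → Expression
unary zero    = one
unary (suc n) = one ⊞ unary n

value-unary : ∀ n → value (unary n) ≡ suc n
value-unary zero    = refl
value-unary (suc n) = cong suc (value-unary n)

ones-unary : ∀ n → ones (unary n) ≡ suc n
ones-unary zero    = refl
ones-unary (suc n) = cong suc (ones-unary n)

value≟ : ∀ v e → Dec (value e ≡ v)
value≟ v e = value e ≟ v

ofValue : ℕ → List Expression
ofValue v = filter (value≟ v) (expressions v)

-- The all-ones sum `unary n` seeds the search. An expression with more than n + 1 ones cannot beat
-- it, so a list containing all those with at most n + 1 ones suffices.
minimizer : ℕ → Expression
minimizer n = argmin ones (unary n) (ofValue (suc n))

opaque

  ‖_‖ : ℕ → ℕ
  ‖ zero ‖  = 0
  ‖ suc n ‖ = ones (minimizer n)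

  ‖‖-correct : ∀ n → ‖ suc n ‖≡ ‖ suc n ‖
  ‖‖-correct n = (minimizer n , argmin-all ones (value-unary n) (all-filter (value≟ (suc n)) (expressions (suc n))) , refl) , minimal
    where
    minimal : ∀ e → value e ≡ suc n → ‖ suc n ‖ ≤ ones e
    minimal e eq with ones e ≤? suc n
    ... | yes le = All.lookup (f[argmin]≤f[xs] {f = ones} (unary n) (ofValue (suc n))) (∈-filter⁺ (value≟ (suc n)) (∈-expressions e le) eq)
    ... | no ≰   = ≤-trans (f[argmin]≤f[⊤] {f = ones} (unary n) (ofValue (suc n)))
                     (≤-trans (≤-reflexive (ones-unary n)) (<⇒≤ (≰⇒> ≰)))

‖value‖≤ones : ∀ e → ‖ value e ‖ ≤ ones e
‖value‖≤ones e = helper (value e) (1≤value e) refl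
  where
  helper : ∀ v → 1 ≤ v → value e ≡ v → ‖ v ‖ ≤ ones e
  helper (suc v) _ eq = proj₂ (‖‖-correct v) e eq

shortest : ∀ {n} → 1 ≤ n → ∃[ e ] value e ≡ n × ones e ≡ ‖ n ‖
shortest {suc n} _ = proj₁ (‖‖-correct n)

1≤‖‖ : ∀ {n} → 1 ≤ n → 1 ≤ ‖ n ‖
1≤‖‖ 1≤n with e , _ , eq ← shortest 1≤n = ≤-trans (1≤ones e) (≤-reflexive eq)

‖1‖≤1 : ‖ 1 ‖ ≤ 1
‖1‖≤1 = ‖value‖≤ones one

‖+‖-≤ : ∀ {a b} → 1 ≤ a → 1 ≤ b → ‖ a + b ‖ ≤ ‖ a ‖ + ‖ b ‖
‖+‖-≤ 1≤a 1≤b with e , refl , p ← shortest 1≤a | f , refl , q ← shortest 1≤b =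
  ≤-trans (‖value‖≤ones (e ⊞ f)) (≤-reflexive (cong₂ _+_ p q))

‖*‖-≤ : ∀ {a b} → 1 ≤ a → 1 ≤ b → ‖ a * b ‖ ≤ ‖ a ‖ + ‖ b ‖
‖*‖-≤ 1≤a 1≤b with e , refl , p ← shortest 1≤a | f , refl , q ← shortest 1≤b =
  ≤-trans (‖value‖≤ones (e ⊠ f)) (≤-reflexive (cong₂ _+_ p q))

‖‖≤n : ∀ {n} → 1 ≤ n → ‖ n ‖ ≤ n
‖‖≤n {suc n} _ = subst₂ _≤_ (cong ‖_‖ (value-unary n)) (ones-unary n) (‖value‖≤ones (unary n))

data Decomposition (n : ℕ) : Set where
  sum     : ∀ {a b} → 1 ≤ a → 1 ≤ b → a + b ≡ n → ‖ a ‖ + ‖ b ‖ ≤ ‖ n ‖ → Decomposition n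
  product : ∀ {a b} → 2 ≤ a → 2 ≤ b → a * b ≡ n → ‖ a ‖ + ‖ b ‖ ≤ ‖ n ‖ → Decomposition n

-- A shortest expression is split at its root. A factor 1 cannot occur there, since the other factor
-- alone would have the same value with fewer ones.
decompose : ∀ {n} → 2 ≤ n → Decomposition n
decompose 2≤n with shortest (<⇒≤ 2≤n)
... | one     , refl , _ = contradiction 2≤n λ { (s≤s ()) }
... | (a ⊞ b) , eq , p = sum (1≤value a) (1≤value b) eq
        (≤-trans (+-mono-≤ (‖value‖≤ones a) (‖value‖≤ones b)) (≤-reflexive p))
... | (a ⊠ b) , eq , p with m≤n⇒m<n∨m≡n (1≤value a) | m≤n⇒m<n∨m≡n (1≤value b)
...   | inj₁ 2≤a | inj₁ 2≤b = product 2≤a 2≤b eq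
        (≤-trans (+-mono-≤ (‖value‖≤ones a) (‖value‖≤ones b)) (≤-reflexive p))
...   | inj₂ 1≡a | _ = contradiction
        (subst (_≤ ones b) (cong ‖_‖ (trans (trans (sym (*-identityˡ (value b))) (cong (_* value b) 1≡a)) eq)) (‖value‖≤ones b))
        (<⇒≱ (≤-trans (m<n+m (ones b) (1≤ones a)) (≤-reflexive p)))
...   | inj₁ _ | inj₂ 1≡b = contradiction
        (subst (_≤ ones a) (cong ‖_‖ (trans (trans (sym (*-identityʳ (value a))) (cong (value a *_) 1≡b)) eq)) (‖value‖≤ones a))
        (<⇒≱ (≤-trans (m<m+n (ones a) (1≤ones b)) (≤-reflexive p)))

-- The first clauses are the values at which the loop of the algorithm stops, the last one is a pass
-- of that loop. The recursion starts at 5 because E(4) = 4 differs from 3 E(1).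
E : ℕ → ℕ
E 0 = 1
E 1 = 1
E 2 = 2
E 3 = 3
E 4 = 4
E (suc (suc (suc n@(suc (suc _))))) = 3 * E n

1≤E : ∀ n → 1 ≤ E n
1≤E 0 = s≤s z≤n
1≤E 1 = s≤s z≤n
1≤E 2 = s≤s z≤n
1≤E 3 = s≤s z≤n
1≤E 4 = s≤s z≤n
1≤E (suc (suc (suc n@(suc (suc _))))) = ≤-trans (1≤E n) (m≤m+n (E n) _)

E-step : ∀ n → E n ≤ E (suc n)
E-step 0 = ≤-refl
E-step 1 = n≤1+n 1
E-step 2 = n≤1+n 2
E-step 3 = n≤1+n 3
E-step 4 = m≤m+n 4 2
E-step (suc (suc (suc n@(suc (suc _))))) = *-monoʳ-≤ 3 (E-step n)

E-mono-≤ : ∀ {m n} → m ≤ n → E m ≤ E n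
E-mono-≤ {m} le with k , refl ← m≤n⇒∃[o]m+o≡n le = helper m k
  where
  helper : ∀ m k → E m ≤ E (m + k)
  helper m zero    = ≤-reflexive (cong E (sym (+-identityʳ m)))
  helper m (suc k) = ≤-trans (E-step m) (≤-trans (helper (suc m) k) (≤-reflexive (cong E (sym (+-suc m k)))))

E-3+ : ∀ {n} → 2 ≤ n → E (3 + n) ≡ 3 * E n
E-3+ {suc (suc n)} _        = refl
E-3+ {suc zero}    (s≤s ())

-- Inequalities about `E` reduce to a finite table for arguments below 5 and to multiplication by 3.
E-rec : ∀ (P : ℕ → Set) → (∀ {n} → n < 5 → P n) → (∀ {n} → 2 ≤ n → P n → P (3 + n)) → ∀ n → P n
E-rec P small step (suc (suc (suc n@(suc (suc _))))) = step (s≤s (s≤s z≤n)) (E-rec P small step n)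
E-rec P small step 0 = small (from-yes (0 <? 5))
E-rec P small step 1 = small (from-yes (1 <? 5))
E-rec P small step 2 = small (from-yes (2 <? 5))
E-rec P small step 3 = small (from-yes (3 <? 5))
E-rec P small step 4 = small (from-yes (4 <? 5))

m+[3+n]≡3+[m+n] : ∀ m n → m + (3 + n) ≡ 3 + (m + n)
m+[3+n]≡3+[m+n] m n = trans (sym (+-assoc m 3 n)) (trans (cong (_+ n) (+-comm m 3)) (+-assoc 3 m n))

E[m]*E[n]≤E[m+n] : ∀ m n → E m * E n ≤ E (m + n)
E[m]*E[n]≤E[m+n] = E-rec _ (λ {m} m<5 → E-rec _ (λ n<5 → small m<5 n<5) (λ {n} → stepʳ m n)) stepˡ
  where
  small : ∀ {m} → m < 5 → ∀ {n} → n < 5 → E m * E n ≤ E (m + n)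
  small = from-yes (allUpTo? (λ m → allUpTo? (λ n → E m * E n ≤? E (m + n)) 5) 5)
  stepˡ : ∀ {m} → 2 ≤ m → (∀ n → E m * E n ≤ E (m + n)) → ∀ n → E (3 + m) * E n ≤ E (3 + m + n)
  stepˡ {m} 2≤m ih n rewrite E-3+ 2≤m | E-3+ (m≤n⇒m≤n+o n 2≤m) =
    ≤-trans (≤-reflexive (*-assoc 3 (E m) (E n))) (*-monoʳ-≤ 3 (ih n))
  stepʳ : ∀ m n → 2 ≤ n → E m * E n ≤ E (m + n) → E m * E (3 + n) ≤ E (m + (3 + n))
  stepʳ m n 2≤n ih rewrite m+[3+n]≡3+[m+n] m n | E-3+ 2≤n | E-3+ (m≤n⇒m≤o+n m 2≤n) = begin
    E m * (3 * E n)  ≡⟨ cong (E m *_) (*-comm 3 (E n)) ⟩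
    E m * (E n * 3)  ≡⟨ *-assoc (E m) (E n) 3 ⟨
    E m * E n * 3    ≡⟨ *-comm (E m * E n) 3 ⟩
    3 * (E m * E n)  ≤⟨ *-monoʳ-≤ 3 ih ⟩
    3 * E (m + n)    ∎
    where open ≤-Reasoning

-- Positivity matters, as E(0) = 1 breaks superadditivity. Increasing one argument by 3 triples one
-- summand on the left and the whole right side.
E[m]+E[n]≤E[m+n] : ∀ m n → 1 ≤ m → 1 ≤ n → E m + E n ≤ E (m + n)
E[m]+E[n]≤E[m+n] m n 1≤m 1≤n = E-rec P (λ {m} m<5 → E-rec _ (λ n<5 → small m<5 n<5) (λ {n} → stepʳ m n)) stepˡ m n 1≤m 1≤n
  where
  P = λ m → ∀ n → 1 ≤ m → 1 ≤ n → E m + E n ≤ E (m + n)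
  small : ∀ {m} → m < 5 → ∀ {n} → n < 5 → 1 ≤ m → 1 ≤ n → E m + E n ≤ E (m + n)
  small = from-yes (allUpTo? (λ m → allUpTo? (λ n → (1 ≤? m) →-dec ((1 ≤? n) →-dec (E m + E n ≤? E (m + n)))) 5) 5)
  stepˡ : ∀ {m} → 2 ≤ m → P m → P (3 + m)
  stepˡ {m} 2≤m ih n _ 1≤n rewrite E-3+ 2≤m | E-3+ (m≤n⇒m≤n+o n 2≤m) = begin
    3 * E m + E n      ≤⟨ +-monoʳ-≤ (3 * E m) (m≤m+n (E n) _) ⟩
    3 * E m + 3 * E n  ≡⟨ *-distribˡ-+ 3 (E m) (E n) ⟨
    3 * (E m + E n)    ≤⟨ *-monoʳ-≤ 3 (ih n (<⇒≤ 2≤m) 1≤n) ⟩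
    3 * E (m + n)      ∎
    where open ≤-Reasoning
  stepʳ : ∀ m n → 2 ≤ n → (1 ≤ m → 1 ≤ n → E m + E n ≤ E (m + n)) → 1 ≤ m → 1 ≤ 3 + n → E m + E (3 + n) ≤ E (m + (3 + n))
  stepʳ m n 2≤n ih 1≤m _ rewrite m+[3+n]≡3+[m+n] m n | E-3+ 2≤n | E-3+ (m≤n⇒m≤o+n m 2≤n) = begin
    E m + 3 * E n      ≤⟨ +-monoˡ-≤ (3 * E n) (m≤m+n (E m) _) ⟩
    3 * E m + 3 * E n  ≡⟨ *-distribˡ-+ 3 (E m) (E n) ⟨
    3 * (E m + E n)    ≤⟨ *-monoʳ-≤ 3 (ih 1≤m (<⇒≤ 2≤n)) ⟩
    3 * E (m + n)      ∎
    where open ≤-Reasoning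

E[n]^3≤3^n : ∀ n → E n ^ 3 ≤ 3 ^ n
E[n]^3≤3^n = E-rec _ (from-yes (allUpTo? (λ n → E n ^ 3 ≤? 3 ^ n) 5)) λ {n} 2≤n ih →
  subst (λ e → e ^ 3 ≤ 3 ^ (3 + n)) (sym (E-3+ 2≤n)) (begin
    (3 * E n) ^ 3     ≡⟨ ^-distribʳ-* 3 3 (E n) ⟩
    27 * E n ^ 3      ≤⟨ *-monoʳ-≤ 27 ih ⟩
    27 * 3 ^ n        ≡⟨ ^-distribˡ-+-* 3 3 n ⟨
    3 ^ (3 + n)       ∎)
  where open ≤-Reasoning

E[n]≤2^n : ∀ n → E n ≤ 2 ^ n
E[n]≤2^n = E-rec _ (from-yes (allUpTo? (λ n → E n ≤? 2 ^ n) 5)) λ {n} 2≤n ih →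
  subst (_≤ 2 ^ (3 + n)) (sym (E-3+ 2≤n)) (begin
    3 * E n      ≤⟨ *-mono-≤ (from-yes (3 ≤? 8)) ih ⟩
    8 * 2 ^ n    ≡⟨ ^-distribˡ-+-* 2 3 n ⟨
    2 ^ (3 + n)  ∎)
  where open ≤-Reasoning

-- The classical bound for the largest number written with k ones: the sum and the product of E(i)
-- and E(j) are at most E(i + j) for positive i and j.
value≤E[ones] : ∀ e → value e ≤ E (ones e)
value≤E[ones] one     = ≤-refl
value≤E[ones] (a ⊞ b) = ≤-trans (+-mono-≤ (value≤E[ones] a) (value≤E[ones] b))
                                (E[m]+E[n]≤E[m+n] (ones a) (ones b) (1≤ones a) (1≤ones b))
value≤E[ones] (a ⊠ b) = ≤-trans (*-mono-≤ (value≤E[ones] a) (value≤E[ones] b)) (E[m]*E[n]≤E[m+n] (ones a) (ones b))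

n≤E[‖n‖] : ∀ {n} → 1 ≤ n → n ≤ E ‖ n ‖
n≤E[‖n‖] 1≤n with e , refl , eq ← shortest 1≤n = subst (λ c → value e ≤ E c) eq (value≤E[ones] e)

‖2n‖≤ : ∀ {n} → 1 ≤ n → ‖ 2 * n ‖ ≤ 2 + ‖ n ‖
‖2n‖≤ {n} 1≤n = ≤-trans (‖*‖-≤ (s≤s z≤n) 1≤n) (+-monoˡ-≤ ‖ n ‖ (‖‖≤n {2} (s≤s z≤n)))

‖3n‖≤ : ∀ {n} → 1 ≤ n → ‖ 3 * n ‖ ≤ 3 + ‖ n ‖
‖3n‖≤ {n} 1≤n = ≤-trans (‖*‖-≤ (s≤s z≤n) 1≤n) (+-monoˡ-≤ ‖ n ‖ (‖‖≤n {3} (s≤s z≤n)))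

‖1+n‖≤ : ∀ {n} → 1 ≤ n → ‖ suc n ‖ ≤ suc ‖ n ‖
‖1+n‖≤ {n} 1≤n = ≤-trans (‖+‖-≤ ≤-refl 1≤n) (+-monoˡ-≤ ‖ n ‖ ‖1‖≤1)

half : ∀ n → (∃[ h ] n ≡ 2 * h) ⊎ (∃[ h ] n ≡ suc (2 * h))
half zero = inj₁ (0 , refl)
half (suc n) with half n
... | inj₁ (h , refl) = inj₂ (h , refl)
... | inj₂ (h , refl) = inj₁ (suc h , sym (*-suc 2 h))

-- Horner's rule in base 2: a binary digit costs at most three ones, while halving divides n^3 by at
-- least 8. The induction rests on 2 and 3, since the inequality fails at 1.
2^‖n‖≤n^3 : ∀ n → 2 ≤ n → 2 ^ ‖ n ‖ ≤ n ^ 3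
2^‖n‖≤n^3 = <-rec _ λ n rec 2≤n → body n rec 2≤n
  where
  open ≤-Reasoning
  body : ∀ n → (∀ {m} → m < n → 2 ≤ m → 2 ^ ‖ m ‖ ≤ m ^ 3) → 2 ≤ n → 2 ^ ‖ n ‖ ≤ n ^ 3
  body n rec 2≤n with half n
  ... | inj₁ (0 , refl) = contradiction 2≤n λ ()
  ... | inj₁ (1 , refl) = ≤-trans (^-monoʳ-≤ 2 (‖‖≤n {2} (s≤s z≤n))) (from-yes (2 ^ 2 ≤? 2 ^ 3))
  ... | inj₂ (0 , refl) = contradiction 2≤n λ { (s≤s ()) }
  ... | inj₂ (1 , refl) = ≤-trans (^-monoʳ-≤ 2 (‖‖≤n {3} (s≤s z≤n))) (from-yes (2 ^ 3 ≤? 3 ^ 3))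
  ... | inj₁ (h@(suc (suc _)) , refl) = begin
    2 ^ ‖ 2 * h ‖    ≤⟨ ^-monoʳ-≤ 2 (‖2n‖≤ {h} (s≤s z≤n)) ⟩
    2 ^ (2 + ‖ h ‖)  ≡⟨ ^-distribˡ-+-* 2 2 ‖ h ‖ ⟩
    4 * 2 ^ ‖ h ‖    ≤⟨ *-mono-≤ (from-yes (4 ≤? 8)) (rec (m<m+n h (s≤s z≤n)) (s≤s (s≤s z≤n))) ⟩
    8 * h ^ 3        ≡⟨ ^-distribʳ-* 3 2 h ⟨
    (2 * h) ^ 3      ∎
  ... | inj₂ (h@(suc (suc _)) , refl) = begin
    2 ^ ‖ suc (2 * h) ‖  ≤⟨ ^-monoʳ-≤ 2 (≤-trans (‖1+n‖≤ {2 * h} (s≤s z≤n)) (s≤s (‖2n‖≤ {h} (s≤s z≤n)))) ⟩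
    2 ^ (3 + ‖ h ‖)      ≡⟨ ^-distribˡ-+-* 2 3 ‖ h ‖ ⟩
    8 * 2 ^ ‖ h ‖        ≤⟨ *-monoʳ-≤ 8 (rec (s≤s (m≤n*m h 2)) (s≤s (s≤s z≤n))) ⟩
    8 * h ^ 3            ≡⟨ ^-distribʳ-* 3 2 h ⟨
    (2 * h) ^ 3          ≤⟨ ^-monoˡ-≤ 3 (n≤1+n (2 * h)) ⟩
    suc (2 * h) ^ 3      ∎

-- Sums over residue classes

Σ< : ℕ → (ℕ → ℕ) → ℕ
Σ< zero    f = 0
Σ< (suc n) f = Σ< n f + f n

Σ<-mono-≤ : ∀ n {f g} → (∀ {i} → i < n → f i ≤ g i) → Σ< n f ≤ Σ< n g
Σ<-mono-≤ zero    f≤g = z≤n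
Σ<-mono-≤ (suc n) f≤g = +-mono-≤ (Σ<-mono-≤ n (λ i<n → f≤g (m<n⇒m<1+n i<n))) (f≤g ≤-refl)

Σ<-cong : ∀ n {f g} → (∀ {i} → i < n → f i ≡ g i) → Σ< n f ≡ Σ< n g
Σ<-cong n f≡g = ≤-antisym (Σ<-mono-≤ n (λ i<n → ≤-reflexive (f≡g i<n))) (Σ<-mono-≤ n (λ i<n → ≤-reflexive (sym (f≡g i<n))))

Σ<-+ : ∀ n f g → Σ< n (λ i → f i + g i) ≡ Σ< n f + Σ< n g
Σ<-+ zero    f g = refl
Σ<-+ (suc n) f g = trans (cong (_+ (f n + g n)) (Σ<-+ n f g)) (interchange +-commutativeSemigroup (Σ< n f) (Σ< n g) (f n) (g n))

Σ<-*ˡ : ∀ n c f → Σ< n (λ i → c * f i) ≡ c * Σ< n f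
Σ<-*ˡ zero    c f = sym (*-zeroʳ c)
Σ<-*ˡ (suc n) c f = trans (cong (_+ c * f n) (Σ<-*ˡ n c f)) (sym (*-distribˡ-+ c (Σ< n f) (f n)))

Σ<-*ʳ : ∀ n c f → Σ< n (λ i → f i * c) ≡ Σ< n f * c
Σ<-*ʳ n c f = trans (Σ<-cong n (λ {i} _ → *-comm (f i) c)) (trans (Σ<-*ˡ n c f) (*-comm c (Σ< n f)))

Σ<-const : ∀ n c → Σ< n (λ _ → c) ≡ n * c
Σ<-const zero    c = refl
Σ<-const (suc n) c = trans (cong (_+ c) (Σ<-const n c)) (+-comm (n * c) c)

Σ<-monoˡ-≤ : ∀ {m n} f → m ≤ n → Σ< m f ≤ Σ< n f
Σ<-monoˡ-≤ {n = zero}  f z≤n = z≤n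
Σ<-monoˡ-≤ {n = suc n} f m≤n with m≤n⇒m<n∨m≡n m≤n
... | inj₁ m<n  = m≤n⇒m≤n+o (f n) (Σ<-monoˡ-≤ f (s≤s⁻¹ m<n))
... | inj₂ refl = ≤-refl

term≤Σ< : ∀ {i n} f → i < n → f i ≤ Σ< n f
term≤Σ< {i} f i<n = ≤-trans (m≤n+m (f i) (Σ< i f)) (Σ<-monoˡ-≤ f i<n)

Σ<-split : ∀ m n f → Σ< (m + n) f ≡ Σ< m f + Σ< n (λ i → f (m + i))
Σ<-split m zero    f = trans (cong (λ l → Σ< l f) (+-identityʳ m)) (sym (+-identityʳ (Σ< m f)))
Σ<-split m (suc n) f = trans (cong (λ l → Σ< l f) (+-suc m n))
  (trans (cong (_+ f (m + n)) (Σ<-split m n f)) (+-assoc (Σ< m f) _ (f (m + n))))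

Σ<-reverse : ∀ n f → Σ< n (λ i → f (n ∸ suc i)) ≡ Σ< n f
Σ<-reverse zero    f = refl
Σ<-reverse (suc n) f = begin
  Σ< (1 + n) (λ i → f (n ∸ i))               ≡⟨ Σ<-split 1 n (λ i → f (n ∸ i)) ⟩
  f n + Σ< n (λ i → f (n ∸ suc i))           ≡⟨ cong (f n +_) (Σ<-reverse n f) ⟩
  f n + Σ< n f                               ≡⟨ +-comm (f n) (Σ< n f) ⟩
  Σ< n f + f n                               ∎
  where open ≡-Reasoning

Σ<-residues : ∀ d h f → Σ< (h * d) f ≡ Σ< d (λ s → Σ< h (λ i → f (s + i * d)))
Σ<-residues d zero    f = sym (trans (Σ<-const d 0) (*-zeroʳ d))
Σ<-residues d (suc h) f = begin
  Σ< (d + h * d) f                                           ≡⟨ cong (λ l → Σ< l f) (+-comm d (h * d)) ⟩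
  Σ< (h * d + d) f                                           ≡⟨ Σ<-split (h * d) d f ⟩
  Σ< (h * d) f + Σ< d (λ s → f (h * d + s))                  ≡⟨ cong₂ _+_ (Σ<-residues d h f) (Σ<-cong d (λ {s} _ → cong f (+-comm (h * d) s))) ⟩
  Σ< d (λ s → Σ< h (λ i → f (s + i * d))) + Σ< d (λ s → f (s + h * d))
                                                             ≡⟨ Σ<-+ d _ _ ⟨
  Σ< d (λ s → Σ< (suc h) (λ i → f (s + i * d)))              ∎
  where open ≡-Reasoning

m<[1+m/n]*n : ∀ m n .{{_ : NonZero n}} → m < suc (m / n) * n
m<[1+m/n]*n m n = begin-strict
  m                    ≡⟨ m≡m%n+[m/n]*n m n ⟩
  m % n + m / n * n    <⟨ +-monoˡ-< (m / n * n) (m%n<n m n) ⟩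
  n + m / n * n        ∎
  where open ≤-Reasoning

Σ≤-residues : ∀ d .{{_ : NonZero d}} X f → Σ< (suc X) f ≤ Σ< d (λ s → Σ< (suc (X / d)) (λ i → f (s + i * d)))
Σ≤-residues d X f = ≤-trans (Σ<-monoˡ-≤ f (m<[1+m/n]*n X d)) (≤-reflexive (Σ<-residues d (suc (X / d)) f))

-- Integer roots, the excess `φ` and the comparison function `g`.

opaque

  root : (q : ℕ) .{{_ : NonZero q}} → ℕ → ℕ
  root q zero    = 0
  root q (suc A) with suc (root q A) ^ q ≤? suc A
  ... | yes _ = suc (root q A)
  ... | no  _ = root q A

  root-lower : ∀ q .{{_ : NonZero q}} A → root q A ^ q ≤ A
  root-lower (suc q) zero = z≤n
  root-lower q (suc A) with suc (root q A) ^ q ≤? suc A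
  ... | yes le = le
  ... | no  _  = m≤n⇒m≤1+n (root-lower q A)

  root-upper : ∀ q .{{_ : NonZero q}} A → A < suc (root q A) ^ q
  root-upper q zero = m^n>0 1 q
  root-upper q (suc A) with suc (root q A) ^ q ≤? suc A
  ... | yes _  = ≤-<-trans (root-upper q A) (^-monoˡ-< q (n<1+n (suc (root q A))))
  ... | no  ≰  = ≰⇒> ≰

≤-root : ∀ q .{{_ : NonZero q}} {m A} → m ^ q ≤ A → m ≤ root q A
≤-root q {m} {A} le = s≤s⁻¹ (≰⇒> λ root<m → <⇒≱ (root-upper q A) (≤-trans (^-monoˡ-≤ q root<m) le))

opaque

  -- 3^(‖n‖/3) / n up to rounding.
  φ : ℕ → ℕ
  φ zero      = 0
  φ n@(suc _) = root 3 (3 ^ ‖ n ‖) / n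

  φ[0]≡0 : φ 0 ≡ 0
  φ[0]≡0 = refl

  φ-upper : ∀ n → (φ n * n) ^ 3 ≤ 3 ^ ‖ n ‖
  φ-upper zero      = z≤n
  φ-upper n@(suc _) = ≤-trans (^-monoˡ-≤ 3 (m/n*n≤m (root 3 (3 ^ ‖ n ‖)) n)) (root-lower 3 (3 ^ ‖ n ‖))

  φ-lower : ∀ {n} → 1 ≤ n → 3 ^ ‖ n ‖ ≤ (suc (φ n) * n) ^ 3
  φ-lower {n@(suc _)} _ = ≤-trans (<⇒≤ (root-upper 3 (3 ^ ‖ n ‖))) (^-monoˡ-≤ 3 (m<[1+m/n]*n (root 3 (3 ^ ‖ n ‖)) n))

φ[1]≤1 : φ 1 ≤ 1
φ[1]≤1 = ≮⇒≥ λ 2≤φ → contradiction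
  (begin
    2 ^ 3          ≤⟨ ^-monoˡ-≤ 3 2≤φ ⟩
    φ 1 ^ 3        ≡⟨ cong (_^ 3) (*-identityʳ (φ 1)) ⟨
    (φ 1 * 1) ^ 3  ≤⟨ φ-upper 1 ⟩
    3 ^ ‖ 1 ‖      ≤⟨ ^-monoʳ-≤ 3 ‖1‖≤1 ⟩
    3 ^ 1          ∎)
  λ { (s≤s (s≤s (s≤s ()))) }
  where open ≤-Reasoning

-- The last hypothesis is 3^(κ/3) / d ≤ u / D, the factor by which 3^(‖n‖/3) / n can exceed
-- 3^(‖q‖/3) / q; cubing removes the roots. The `suc` on the right makes up for the rounding down in
-- φ(q).
φ-step : ∀ {n q d D u} κ → 1 ≤ q → d * q ≤ n → ‖ n ‖ ≤ κ + ‖ q ‖ → .{{_ : NonZero d}} →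
         D ^ 3 * 3 ^ κ ≤ (d * u) ^ 3 → D * φ n ≤ u * suc (φ q)
φ-step {n} {q@(suc _)} {d} {D} {u} κ 1≤q dq≤n ‖n‖≤ ineq = *-cancelʳ-≤ _ _ (d * q) {{m*n≢0 d q}} (^-cancelˡ-≤ 3 (begin
  (D * φ n * (d * q)) ^ 3               ≤⟨ ^-monoˡ-≤ 3 (*-monoʳ-≤ (D * φ n) dq≤n) ⟩
  (D * φ n * n) ^ 3                     ≡⟨ cong (_^ 3) (*-assoc D (φ n) n) ⟩
  (D * (φ n * n)) ^ 3                   ≡⟨ ^-distribʳ-* 3 D (φ n * n) ⟩
  D ^ 3 * (φ n * n) ^ 3                 ≤⟨ *-monoʳ-≤ (D ^ 3) (φ-upper n) ⟩
  D ^ 3 * 3 ^ ‖ n ‖                     ≤⟨ *-monoʳ-≤ (D ^ 3) (^-monoʳ-≤ 3 ‖n‖≤) ⟩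
  D ^ 3 * 3 ^ (κ + ‖ q ‖)               ≡⟨ cong (D ^ 3 *_) (^-distribˡ-+-* 3 κ ‖ q ‖) ⟩
  D ^ 3 * (3 ^ κ * 3 ^ ‖ q ‖)           ≡⟨ *-assoc (D ^ 3) (3 ^ κ) (3 ^ ‖ q ‖) ⟨
  D ^ 3 * 3 ^ κ * 3 ^ ‖ q ‖             ≤⟨ *-mono-≤ ineq (φ-lower 1≤q) ⟩
  (d * u) ^ 3 * (suc (φ q) * q) ^ 3     ≡⟨ ^-distribʳ-* 3 (d * u) (suc (φ q) * q) ⟨
  (d * u * (suc (φ q) * q)) ^ 3         ≡⟨ cong (_^ 3) (rearrange d u (suc (φ q)) q) ⟩
  (u * suc (φ q) * (d * q)) ^ 3         ∎))
  where
  open ≤-Reasoning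
  rearrange : ∀ d u s q → d * u * (s * q) ≡ u * s * (d * q)
  rearrange = solve-∀

-- The scale of the rational constants below, opaque so that products with
-- it are never unfolded.
opaque

  D : ℕ
  D = 10000

  D≡10000 : D ≡ 10000
  D≡10000 = refl

atD : (P : ℕ → Set) → P 10000 → P D
atD P = subst P (sym D≡10000)

2≤D : 2 ≤ D
2≤D = atD (2 ≤_) (s≤s (s≤s z≤n))

-- D · X^(11/9) up to rounding.
g : ℕ → ℕ
g X = root 9 (D ^ 9 * X ^ 11)

g-lower : ∀ {X} → 1 ≤ X → D * X ≤ g X
g-lower {X} 1≤X = ≤-root 9 (begin
  (D * X) ^ 9        ≡⟨ ^-distribʳ-* 9 D X ⟩
  D ^ 9 * X ^ 9      ≤⟨ *-monoʳ-≤ (D ^ 9) (^-monoʳ-≤ X {{>-nonZero 1≤X}} (m≤m+n 9 2)) ⟩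
  D ^ 9 * X ^ 11     ∎)
  where open ≤-Reasoning

D≤g : ∀ {X} → 1 ≤ X → D ≤ g X
D≤g {X} 1≤X = ≤-trans (m≤m*n D X {{>-nonZero 1≤X}}) (g-lower 1≤X)

1+X≤g : ∀ {X} → 1 ≤ X → suc X ≤ g X
1+X≤g {X} 1≤X = ≤-trans (+-mono-≤ 1≤X (m≤m+n X 0)) (≤-trans (*-monoˡ-≤ X 2≤D) (g-lower 1≤X))

-- The hypothesis says a / D ≥ d^(-11/9), the exact scaling factor. Passing from a to `suc a` pays
-- for the rounded root, as the excess a is at most D ≤ g X.
g-step : ∀ {d a} .{{_ : NonZero d}} → D ^ 9 ≤ a ^ 9 * d ^ 11 → a ≤ D →
         ∀ {X} → 1 ≤ X → D * g (X / d) ≤ suc a * g X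
g-step {d} {a} ineq a≤ {X} 1≤X = begin
  D * g h        ≤⟨ ^-cancelˡ-≤ 9 (begin
    (D * g h) ^ 9                       ≡⟨ ^-distribʳ-* 9 D (g h) ⟩
    D ^ 9 * g h ^ 9                     ≤⟨ *-mono-≤ ineq (root-lower 9 (D ^ 9 * h ^ 11)) ⟩
    a ^ 9 * d ^ 11 * (D ^ 9 * h ^ 11)   ≡⟨ rearrange (a ^ 9) (d ^ 11) (D ^ 9) (h ^ 11) ⟩
    a ^ 9 * (D ^ 9 * (h ^ 11 * d ^ 11)) ≡⟨ cong (λ z → a ^ 9 * (D ^ 9 * z)) (^-distribʳ-* 11 h d) ⟨
    a ^ 9 * (D ^ 9 * (h * d) ^ 11)      ≤⟨ *-monoʳ-≤ (a ^ 9) (*-monoʳ-≤ (D ^ 9) (^-monoˡ-≤ 11 (m/n*n≤m X d))) ⟩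
    a ^ 9 * (D ^ 9 * X ^ 11)            ≤⟨ *-monoʳ-≤ (a ^ 9) (<⇒≤ (root-upper 9 (D ^ 9 * X ^ 11))) ⟩
    a ^ 9 * suc (g X) ^ 9                   ≡⟨ ^-distribʳ-* 9 a (suc (g X)) ⟨
    (a * suc (g X)) ^ 9                     ∎) ⟩
  a * suc (g X)      ≡⟨ *-suc a (g X) ⟩
  a + a * g X        ≤⟨ +-monoˡ-≤ (a * g X) (≤-trans a≤ (D≤g 1≤X)) ⟩
  g X + a * g X      ∎
  where
  open ≤-Reasoning
  h = X / d
  rearrange : ∀ a b c d → a * b * (c * d) ≡ a * (c * (d * b))
  rearrange = solve-∀

-- The recursion over residue classes mod 36 and its supersolution.

module Descent where

  -- Here X bounds the position of a member within its class mod 36, not its size.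
  S : ℕ → ℕ → ℕ
  S c X = Σ< (suc X) (λ j → φ (c + j * 36))

  S-mono-≤ : ∀ c {X Y} → X ≤ Y → S c X ≤ S c Y
  S-mono-≤ c X≤Y = Σ<-monoˡ-≤ (λ j → φ (c + j * 36)) (s≤s X≤Y)

  -- A descent n = r + d q ↦ q costs a factor u / D in φ and gains a factor
  -- γ / D in g.
  record Move : Set where
    field
      d e r u γ : ℕ
      {{d≢0}}   : NonZero d
      d≤3       : d ≤ 3
      1<d       : 1 < d
      e*d≡36    : e * d ≡ 36
      φ-descent : ∀ q → D * φ (r + d * q) ≤ u * suc (φ q)
      g-descent : ∀ {X} → 1 ≤ X → D * g (X / d) ≤ γ * g X

  open Move

  -- Under n = r + d q the quotients are c + j e with e = 36 / d. Writing j = s + i d sorts them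
  -- into the classes c + s e mod 36, with i up to X / d. The added ones of the descent sum to
  -- `suc X`.
  S-step : ∀ μ c X → D * S (r μ + d μ * c) X ≤ u μ * (suc X + Σ< (d μ) (λ s → S (c + s * e μ) (X / d μ)))
  S-step μ c X = begin
    D * S (r μ + d μ * c) X
      ≡⟨ Σ<-*ˡ (suc X) D (λ j → φ (r μ + d μ * c + j * 36)) ⟨
    Σ< (suc X) (λ j → D * φ (r μ + d μ * c + j * 36))
      ≤⟨ Σ<-mono-≤ (suc X) (λ {j} _ → ≤-trans (≤-reflexive (cong (λ n → D * φ n) (index j))) (φ-descent μ (c + j * e μ))) ⟩
    Σ< (suc X) (λ j → u μ * suc (φ (c + j * e μ)))
      ≡⟨ Σ<-*ˡ (suc X) (u μ) (λ j → suc (φ (c + j * e μ))) ⟩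
    u μ * Σ< (suc X) (λ j → 1 + φ (c + j * e μ))
      ≡⟨ cong (u μ *_) (Σ<-+ (suc X) (λ _ → 1) (λ j → φ (c + j * e μ))) ⟩
    u μ * (Σ< (suc X) (λ _ → 1) + Σ< (suc X) (λ j → φ (c + j * e μ)))
      ≤⟨ *-monoʳ-≤ (u μ) (+-mono-≤ (≤-reflexive (trans (Σ<-const (suc X) 1) (*-identityʳ (suc X)))) (Σ≤-residues (d μ) X (λ j → φ (c + j * e μ)))) ⟩
    u μ * (suc X + Σ< (d μ) (λ s → Σ< (suc (X / d μ)) (λ i → φ (c + (s + i * d μ) * e μ))))
      ≡⟨ cong (λ z → u μ * (suc X + z)) (Σ<-cong (d μ) (λ {s} _ → Σ<-cong (suc (X / d μ)) (λ {i} _ → cong φ (residue s i)))) ⟩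
    u μ * (suc X + Σ< (d μ) (λ s → S (c + s * e μ) (X / d μ)))
      ∎
    where
    open ≤-Reasoning
    expand₁ : ∀ r d c j e → r + d * c + j * (e * d) ≡ r + d * (c + j * e)
    expand₁ = solve-∀
    index : ∀ j → r μ + d μ * c + j * 36 ≡ r μ + d μ * (c + j * e μ)
    index j = trans (cong (λ z → r μ + d μ * c + j * z) (sym (e*d≡36 μ))) (expand₁ (r μ) (d μ) c j (e μ))
    expand₂ : ∀ c s i d e → c + (s + i * d) * e ≡ c + s * e + i * (e * d)
    expand₂ = solve-∀
    residue : ∀ s i → c + (s + i * d μ) * e μ ≡ c + s * e μ + i * 36
    residue s i = trans (expand₂ c s i (d μ) (e μ)) (cong (λ z → c + s * e μ + i * z) (e*d≡36 μ))

  φ-descent-0 : ∀ {d u κ} .{{_ : NonZero d}} → (∀ {q} → 1 ≤ q → ‖ d * q ‖ ≤ κ + ‖ q ‖) →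
                D ^ 3 * 3 ^ κ ≤ (d * u) ^ 3 → ∀ q → D * φ (d * q) ≤ u * suc (φ q)
  φ-descent-0 {d} {u} _ _ zero rewrite *-zeroʳ d | φ[0]≡0 | *-zeroʳ D = z≤n
  φ-descent-0 {d} {u} {κ} bound ineq q@(suc _) =
    φ-step {d * q} {q} {d} {D} {u} κ (s≤s z≤n) ≤-refl (bound (s≤s z≤n)) ineq

  -- For q = 0 the number is 1 and has no positive quotient to descend to; φ(1) ≤ 1 and D ≤ u cover
  -- it.
  φ-descent-1 : ∀ {d u κ} .{{_ : NonZero d}} → (∀ {q} → 1 ≤ q → ‖ d * q ‖ ≤ κ + ‖ q ‖) →
                D ≤ u → D ^ 3 * 3 ^ suc κ ≤ (d * u) ^ 3 → ∀ q → D * φ (suc (d * q)) ≤ u * suc (φ q)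
  φ-descent-1 {d} {u} _ D≤u _ zero rewrite *-zeroʳ d = *-mono-≤ D≤u (≤-trans φ[1]≤1 (s≤s z≤n))
  φ-descent-1 {d} {u} {κ} bound _ ineq q@(suc _) =
    φ-step {suc (d * q)} {q} {d} {D} {u} (suc κ) (s≤s z≤n) (n≤1+n (d * q))
      (≤-trans (‖1+n‖≤ (*-mono-≤ {1} (>-nonZero⁻¹ d) (s≤s z≤n))) (s≤s (bound (s≤s z≤n)))) ineq

  -- `u` is D 3^(κ/3) / d rounded up, where κ = 2, 3, 3, 4 is the number of ones spent, and `γ` is D
  -- d^(-11/9) rounded up, plus one for the rounding in `g`.
  double double+1 triple triple+1 : Move
  double = record
    { d = 2 ; e = 18 ; r = 0 ; u = 10401 ; γ = 4288
    ; d≤3 = s≤s (s≤s z≤n) ; 1<d = ≤-refl ; e*d≡36 = refl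
    ; φ-descent = φ-descent-0 {2} {10401} {2} ‖2n‖≤ (atD (λ D → D ^ 3 * 3 ^ 2 ≤ (2 * 10401) ^ 3) (≤ᵇ⇒≤ _ _ tt))
    ; g-descent = g-step {2} {4287} (atD (λ D → D ^ 9 ≤ 4287 ^ 9 * 2 ^ 11) (≤ᵇ⇒≤ _ _ tt)) (atD (4287 ≤_) (≤ᵇ⇒≤ _ _ tt))
    }
  double+1 = record
    { d = 2 ; e = 18 ; r = 1 ; u = 15000 ; γ = 4288
    ; d≤3 = s≤s (s≤s z≤n) ; 1<d = ≤-refl ; e*d≡36 = refl
    ; φ-descent = φ-descent-1 {2} {15000} {2} ‖2n‖≤ (atD (_≤ 15000) (≤ᵇ⇒≤ _ _ tt)) (atD (λ D → D ^ 3 * 3 ^ 3 ≤ (2 * 15000) ^ 3) (≤ᵇ⇒≤ _ _ tt))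
    ; g-descent = g-descent double
    }
  triple = record
    { d = 3 ; e = 12 ; r = 0 ; u = 10000 ; γ = 2613
    ; d≤3 = ≤-refl ; 1<d = s≤s (s≤s z≤n) ; e*d≡36 = refl
    ; φ-descent = φ-descent-0 {3} {10000} {3} ‖3n‖≤ (atD (λ D → D ^ 3 * 3 ^ 3 ≤ (3 * 10000) ^ 3) (≤ᵇ⇒≤ _ _ tt))
    ; g-descent = g-step {3} {2612} (atD (λ D → D ^ 9 ≤ 2612 ^ 9 * 3 ^ 11) (≤ᵇ⇒≤ _ _ tt)) (atD (2612 ≤_) (≤ᵇ⇒≤ _ _ tt))
    }
  triple+1 = record
    { d = 3 ; e = 12 ; r = 1 ; u = 14423 ; γ = 2613
    ; d≤3 = ≤-refl ; 1<d = s≤s (s≤s z≤n) ; e*d≡36 = refl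
    ; φ-descent = φ-descent-1 {3} {14423} {3} ‖3n‖≤ (atD (_≤ 14423) (≤ᵇ⇒≤ _ _ tt)) (atD (λ D → D ^ 3 * 3 ^ 4 ≤ (3 * 14423) ^ 3) (≤ᵇ⇒≤ _ _ tt))
    ; g-descent = g-descent triple
    }

  -- The weights are a rounded Perron eigenvector of the 36 × 36 matrix of
  -- descents that minimises the spectral radius.
  policy : List (Move × ℕ)
  policy =
    (triple , 259) ∷ (double+1 , 373) ∷ (double , 373) ∷ (triple , 373) ∷
    (double , 362) ∷ (double+1 , 521) ∷ (double , 373) ∷ (double+1 , 538) ∷
    (double , 459) ∷ (triple , 339) ∷ (triple+1 , 489) ∷ (double+1 , 1074) ∷
    (double , 340) ∷ (double+1 , 491) ∷ (double , 491) ∷ (triple , 491) ∷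
    (double , 455) ∷ (double+1 , 656) ∷ (triple , 318) ∷ (triple+1 , 459) ∷
    (double , 434) ∷ (triple , 459) ∷ (triple+1 , 662) ∷ (double+1 , 1141) ∷
    (triple , 386) ∷ (double+1 , 557) ∷ (double , 557) ∷ (triple , 428) ∷
    (double , 478) ∷ (double+1 , 690) ∷ (triple , 521) ∷ (triple+1 , 751) ∷
    (double , 577) ∷ (double+1 , 832) ∷ (double , 832) ∷ (double+1 , 1200) ∷ []

  at : List (Move × ℕ) → ℕ → Move × ℕ
  at []       _       = double , 0
  at (x ∷ _)  zero    = x
  at (_ ∷ xs) (suc c) = at xs c

  move : ℕ → Move
  move c = proj₁ (at policy c)

  weight : ℕ → ℕ
  weight c = proj₂ (at policy c)

  -- The first condition says that c has the remainder r required by the move, the second that the d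
  -- successor classes lie in the table. The third is (u/D) (1 + (γ/D) H) ≤ weight of c with
  -- denominators cleared, H being the sum of the successor weights; the 1 is reserved for the
  -- linear error term.
  DescendsTo : ℕ → Move → ℕ → Set
  DescendsTo D μ c = c ≡ r μ + d μ * (c / d μ)
                   × (∀ {s} → s < d μ → c / d μ + s * e μ < 36)
                   × u μ * (D + γ μ * Σ< (d μ) (λ s → weight (c / d μ + s * e μ))) ≤ (D * D) * weight c

  -- A finite check: 36 inequalities between concrete integers, decided at 10000 and transported to
  -- the opaque `D`.
  supersolution : ∀ {c} → c < 36 → DescendsTo D (move c) c
  supersolution = atD (λ D → ∀ {c} → c < 36 → DescendsTo D (move c) c) (from-yes (allUpTo? (λ c → descends? 10000 (move c) c) 36))
    where
    descends? : ∀ D μ c → Dec (DescendsTo D μ c)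
    descends? D μ c =
      (c ≟ r μ + d μ * (c / d μ)) ×-dec
      (allUpTo? (λ s → c / d μ + s * e μ <? 36) (d μ)) ×-dec
      (u μ * (D + γ μ * Σ< (d μ) (λ s → weight (c / d μ + s * e μ))) ≤? (D * D) * weight c)

  opaque

    -- Large enough for X < 3, where a quotient X / d may be 0 and `g` vanishes, and at least 1 so
    -- that g X ≤ κ * g X.
    κ : ℕ
    κ = 1 + 3 * Σ< 108 φ

    3*Σφ≤κ : 3 * Σ< 108 φ ≤ κ
    3*Σφ≤κ = n≤1+n _

    1≤κ : 1 ≤ κ
    1≤κ = s≤s z≤n

  1≤weight : ∀ {c} → c < 36 → 1 ≤ weight c
  1≤weight = from-yes (allUpTo? (λ c → 1 ≤? weight c) 36)

  S-base : ∀ {c X} → c < 36 → X < 3 → S c X ≤ κ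
  S-base {c} {X} c<36 X<3 = begin
    S c X                    ≤⟨ Σ<-monoˡ-≤ {suc X} {3} (λ j → φ (c + j * 36)) X<3 ⟩
    -- With c < 36 and j ≤ 2 every argument is below 3 * 36 = 108.
    Σ< 3 (λ j → φ (c + j * 36)) ≤⟨ Σ<-mono-≤ 3 (λ {j} j<3 → term≤Σ< φ (+-mono-≤ {suc c} c<36 (*-monoˡ-≤ 36 (s≤s⁻¹ j<3)))) ⟩
    Σ< 3 (λ _ → Σ< 108 φ)    ≡⟨ Σ<-const 3 (Σ< 108 φ) ⟩
    3 * Σ< 108 φ             ≤⟨ 3*Σφ≤κ ⟩
    κ                        ∎
    where open ≤-Reasoning

  -- Strong induction on X. From X = 3 on, X / d is positive for d ≤ 3, so the induction hypothesis
  -- applies to every successor class.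
  S≤g : ∀ X → 1 ≤ X → ∀ c → c < 36 → S c X ≤ κ * weight c * g X
  S≤g = <-rec (λ X → 1 ≤ X → ∀ c → c < 36 → S c X ≤ κ * weight c * g X)
    λ X rec 1≤X c → body X (λ h<X 1≤h {c} → rec h<X 1≤h c) 1≤X {c}
    where
    open ≤-Reasoning
    rearrange₁ : ∀ a κ w G → a * (κ * w * G) ≡ κ * w * (a * G)
    rearrange₁ = solve-∀
    rearrange₂ : ∀ u a G κ H γ → u * (a * (κ * G) + κ * H * (γ * G)) ≡ κ * G * (u * (a + γ * H))
    rearrange₂ = solve-∀
    rearrange₃ : ∀ κ w G a → κ * G * (a * w) ≡ a * (κ * w * G)
    rearrange₃ = solve-∀
    rearrange₄ : ∀ a u X Y → a * (u * (X + Y)) ≡ u * (a * X + a * Y)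
    rearrange₄ = solve-∀
    rec-case : ∀ X → (∀ {h} → h < X → 1 ≤ h → ∀ {c} → c < 36 → S c h ≤ κ * weight c * g h) →
               3 ≤ X → ∀ μ c → DescendsTo D μ c → S c X ≤ κ * weight c * g X
    rec-case X rec 3≤X μ c (c≡ , c′<36 , ineq) = *-cancelˡ-≤ (D * D) {{m*n≢0 D D {{D≢0}} {{D≢0}}}} (begin
      (D * D) * S c X
        ≡⟨ *-assoc D D (S c X) ⟩
      D * (D * S c X)
        ≡⟨ cong (λ z → D * (D * S z X)) c≡ ⟩
      D * (D * S (r μ + d μ * c′) X)
        ≤⟨ *-monoʳ-≤ D (S-step μ c′ X) ⟩
      D * (u μ * (suc X + Σ< (d μ) (λ s → S (c′ + s * e μ) h)))
        ≡⟨ rearrange₄ D (u μ) (suc X) _ ⟩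
      u μ * (D * suc X + D * Σ< (d μ) (λ s → S (c′ + s * e μ) h))
        -- The linear error is bounded by the main term: `suc X` ≤ g X ≤ κ * g X. The summand `D` in
        -- `DescendsTo` pays for it.
        ≤⟨ *-monoʳ-≤ (u μ) (+-mono-≤ (*-monoʳ-≤ D (≤-trans (1+X≤g 1≤X) (m≤n*m (g X) κ {{>-nonZero 1≤κ}})))
             (*-monoʳ-≤ D (Σ<-mono-≤ (d μ) (λ s<d → rec (m/n<m X (d μ) {{>-nonZero 1≤X}} {{d≢0 μ}} (1<d μ)) 1≤h (c′<36 s<d))))) ⟩
      u μ * (D * (κ * g X) + D * Σ< (d μ) (λ s → κ * weight (c′ + s * e μ) * g h))
        ≡⟨ cong (λ z → u μ * (D * (κ * g X) + D * z)) (trans (Σ<-*ʳ (d μ) (g h) _) (cong (_* g h) (Σ<-*ˡ (d μ) κ _))) ⟩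
      u μ * (D * (κ * g X) + D * (κ * H * g h))
        ≡⟨ cong (λ z → u μ * (D * (κ * g X) + z)) (rearrange₁ D κ H (g h)) ⟩
      u μ * (D * (κ * g X) + κ * H * (D * g h))
        ≤⟨ *-monoʳ-≤ (u μ) (+-monoʳ-≤ (D * (κ * g X)) (*-monoʳ-≤ (κ * H) (g-descent μ 1≤X))) ⟩
      u μ * (D * (κ * g X) + κ * H * (γ μ * g X))
        ≡⟨ rearrange₂ (u μ) D (g X) κ H (γ μ) ⟩
      κ * g X * (u μ * (D + γ μ * H))
        ≤⟨ *-monoʳ-≤ (κ * g X) ineq ⟩
      κ * g X * ((D * D) * weight c)
        ≡⟨ rearrange₃ κ (weight c) (g X) (D * D) ⟩
      (D * D) * (κ * weight c * g X)
        ∎)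
      where
      1≤X = <⇒≤ (<⇒≤ 3≤X)
      c′ = c / d μ
      h = X / d μ
      H = Σ< (d μ) (λ s → weight (c′ + s * e μ))
      D≢0 = >-nonZero (<⇒≤ 2≤D)
      1≤h : 1 ≤ h
      1≤h = m≥n⇒m/n>0 (≤-trans (d≤3 μ) 3≤X)
    body : ∀ X → (∀ {h} → h < X → 1 ≤ h → ∀ {c} → c < 36 → S c h ≤ κ * weight c * g h) →
           1 ≤ X → ∀ {c} → c < 36 → S c X ≤ κ * weight c * g X
    body X rec 1≤X {c} c<36 with X <? 3
    ... | yes X<3 = begin
      S c X                ≤⟨ S-base c<36 X<3 ⟩
      κ                    ≤⟨ m≤m*n κ (weight c) {{>-nonZero (1≤weight c<36)}} ⟩
      κ * weight c         ≤⟨ m≤m*n (κ * weight c) (g X) {{>-nonZero (≤-trans (s≤s z≤n) (1+X≤g 1≤X))}} ⟩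
      κ * weight c * g X   ∎
    ... | no X≮3 = rec-case X rec (≮⇒≥ X≮3) (move c) c (supersolution c<36)

  Σφ≤g : ∃[ C ] ∀ {M} → 1 ≤ M → Σ< (suc M) φ ≤ C * g M
  Σφ≤g = κ * Σ< 36 weight , λ {M} 1≤M → begin
    Σ< (suc M) φ                               ≤⟨ Σ≤-residues 36 M φ ⟩
    Σ< 36 (λ c → S c (M / 36))                 ≤⟨ Σ<-mono-≤ 36 (λ {c} _ → S-mono-≤ c (m/n≤m M 36)) ⟩
    Σ< 36 (λ c → S c M)                        ≤⟨ Σ<-mono-≤ 36 (λ {c} → S≤g M 1≤M c) ⟩
    Σ< 36 (λ c → κ * weight c * g M)           ≡⟨ trans (Σ<-*ʳ 36 (g M) (λ c → κ * weight c)) (cong (_* g M) (Σ<-*ˡ 36 κ weight)) ⟩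
    κ * Σ< 36 weight * g M                     ∎
    where open ≤-Reasoning

open Descent using (Σφ≤g)

-- Bounds for kMax and for the growth of the running time

-- With T = ‖n‖ and t ≤ T - t, n is less than 2 E(T - t). Hence E(t) n ≤ 2 E(t) E(T - t) ≤ 2 E(T) ≤
-- 2 * 3^(T/3), and 3^(T/3) is at most (1 + φ(n)) n.
E[t]≤2[1+φ] : ∀ {n t} → 1 ≤ n → 2 * t ≤ ‖ n ‖ → suc n ≤ E t + E (‖ n ‖ ∸ t) → E t ≤ 2 * suc (φ n)
E[t]≤2[1+φ] {n@(suc _)} {t} 1≤n 2t≤T n<sum = *-cancelʳ-≤ (E t) (2 * suc (φ n)) n (^-cancelˡ-≤ 3 (begin
  (E t * n) ^ 3                         ≤⟨ ^-monoˡ-≤ 3 E[t]n≤2E[T] ⟩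
  (2 * E T) ^ 3                         ≡⟨ ^-distribʳ-* 3 2 (E T) ⟩
  8 * E T ^ 3                           ≤⟨ *-monoʳ-≤ 8 (≤-trans (E[n]^3≤3^n T) (φ-lower 1≤n)) ⟩
  8 * (suc (φ n) * n) ^ 3               ≡⟨ ^-distribʳ-* 3 2 (suc (φ n) * n) ⟨
  (2 * (suc (φ n) * n)) ^ 3             ≡⟨ cong (_^ 3) (*-assoc 2 (suc (φ n)) n) ⟨
  (2 * suc (φ n) * n) ^ 3               ∎))
  where
  open ≤-Reasoning
  T = ‖ n ‖
  t≤T : t ≤ T
  t≤T = ≤-trans (m≤m+n t (t + 0)) 2t≤T
  t≤T∸t : t ≤ T ∸ t
  t≤T∸t = ≤-trans (≤-reflexive (sym (trans (cong (_∸ t) (cong (t +_) (+-identityʳ t))) (m+n∸m≡n t t)))) (∸-monoˡ-≤ t 2t≤T)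
  rearrange : ∀ a b → a * (b + b) ≡ 2 * (a * b)
  rearrange = solve-∀
  E[t]n≤2E[T] : E t * n ≤ 2 * E T
  E[t]n≤2E[T] = begin
    E t * n                          ≤⟨ *-monoʳ-≤ (E t) (≤-trans (n≤1+n n) n<sum) ⟩
    E t * (E t + E (T ∸ t))          ≤⟨ *-monoʳ-≤ (E t) (+-monoˡ-≤ (E (T ∸ t)) (E-mono-≤ t≤T∸t)) ⟩
    E t * (E (T ∸ t) + E (T ∸ t))    ≡⟨ rearrange (E t) (E (T ∸ t)) ⟩
    2 * (E t * E (T ∸ t))            ≤⟨ *-monoʳ-≤ 2 (E[m]*E[n]≤E[m+n] t (T ∸ t)) ⟩
    2 * E (t + (T ∸ t))              ≡⟨ cong (λ z → 2 * E z) (m+[n∸m]≡n t≤T) ⟩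
    2 * E T                          ∎

-- Keeps kMax below the number being processed, so that n - m stays positive in step (3). With T =
-- ‖n‖, E(t)^2 ≤ E(2t) ≤ E(T) gives E(t)^6 ≤ 3^T ≤ 4^T ≤ n^6.
E[t]≤n : ∀ {n t} → 1 ≤ n → 2 * t ≤ ‖ n ‖ → E t ≤ n
E[t]≤n {1}              {zero}  _ _     = ≤-refl
E[t]≤n {1}              {suc t} _ 2t≤T  = contradiction (≤-trans 2t≤T ‖1‖≤1) (<⇒≱ (+-mono-≤ {1} {suc t} {1} (s≤s z≤n) (s≤s z≤n)))
E[t]≤n {n@(suc (suc _))} {t}    _ 2t≤T  = ^-cancelˡ-≤ 6 (begin
  E t ^ 6                ≡⟨ ^-*-assoc (E t) 2 3 ⟨
  (E t ^ 2) ^ 3          ≡⟨ cong (λ z → (E t * z) ^ 3) (*-identityʳ (E t)) ⟩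
  (E t * E t) ^ 3        ≤⟨ ^-monoˡ-≤ 3 (E[m]*E[n]≤E[m+n] t t) ⟩
  E (t + t) ^ 3          ≤⟨ ^-monoˡ-≤ 3 (E-mono-≤ (≤-trans (≤-reflexive (cong (t +_) (sym (+-identityʳ t)))) 2t≤T)) ⟩
  E ‖ n ‖ ^ 3            ≤⟨ E[n]^3≤3^n ‖ n ‖ ⟩
  3 ^ ‖ n ‖              ≤⟨ ^-monoˡ-≤ ‖ n ‖ (n≤1+n 3) ⟩
  (2 ^ 2) ^ ‖ n ‖        ≡⟨ trans (^-*-assoc 2 2 ‖ n ‖) (trans (cong (2 ^_) (*-comm 2 ‖ n ‖)) (sym (^-*-assoc 2 ‖ n ‖ 2))) ⟩
  (2 ^ ‖ n ‖) ^ 2        ≤⟨ ^-monoˡ-≤ 2 (2^‖n‖≤n^3 n (s≤s (s≤s z≤n))) ⟩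
  (n ^ 3) ^ 2            ≡⟨ ^-*-assoc n 3 2 ⟩
  n ^ 6                  ∎)
  where open ≤-Reasoning

infixl 7 _÷_

-- Total with m ÷ 0 = 0, so that harmonic sums can start at 0 and be split into residues.
_÷_ : ℕ → ℕ → ℕ
m ÷ zero  = 0
m ÷ suc n = m / suc n

÷-anti : ∀ m {n o} → 1 ≤ n → n ≤ o → m ÷ o ≤ m ÷ n
÷-anti m {suc n} {suc o} _ n≤o = /-monoʳ-≤ m n≤o

2[m÷2n]≤m÷n : ∀ m n → m ÷ (2 * n) + m ÷ (2 * n) ≤ m ÷ n
2[m÷2n]≤m÷n m zero    = z≤n
2[m÷2n]≤m÷n m (suc n) = s≤s⁻¹ (*-cancelʳ-< (suc n) (q + q) (suc (m / suc n)) (begin-strict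
  (q + q) * suc n           ≡⟨ rearrange q (suc n) ⟩
  q * (2 * suc n)           ≤⟨ m/n*n≤m m (2 * suc n) ⟩
  m                         <⟨ m<[1+m/n]*n m (suc n) ⟩
  suc (m / suc n) * suc n   ∎))
  where
  open ≤-Reasoning
  q = m ÷ (2 * suc n)
  rearrange : ∀ q n → (q + q) * n ≡ q * (2 * n)
  rearrange = solve-∀

-- The terms with indices 2i and 2i + 1 together are at most m ÷ i, and the pair i = 0 contributes
-- m. So each halving of the range costs m.
Σ÷-harmonic : ∀ m k {X} → X < 2 ^ k → Σ< (suc X) (m ÷_) ≤ m * k
Σ÷-harmonic m zero    {zero}  _         = z≤n
Σ÷-harmonic m zero    {suc X} (s≤s ())
Σ÷-harmonic m (suc k) {X}     X<2^[1+k] = begin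
  Σ< (suc X) (m ÷_)                                            ≤⟨ Σ≤-residues 2 X (m ÷_) ⟩
  Σ< 2 (λ s → Σ< (suc (X / 2)) (λ i → m ÷ (s + i * 2)))        ≡⟨ Σ<-+ (suc (X / 2)) (λ i → m ÷ (i * 2)) (λ i → m ÷ (1 + i * 2)) ⟨
  Σ< (suc (X / 2)) (λ i → m ÷ (i * 2) + m ÷ (1 + i * 2))       ≡⟨ Σ<-split 1 (X / 2) _ ⟩
  m / 1 + Σ< (X / 2) (λ i → m ÷ (suc i * 2) + m ÷ (1 + suc i * 2)) ≤⟨ +-mono-≤ (≤-reflexive (n/1≡n m)) (Σ<-mono-≤ (X / 2) (λ {i} _ → pair i)) ⟩
  m + Σ< (X / 2) (λ i → m ÷ suc i)                             ≡⟨ cong (m +_) (Σ<-split 1 (X / 2) (m ÷_)) ⟨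
  m + Σ< (suc (X / 2)) (m ÷_)                                  ≤⟨ +-monoʳ-≤ m (Σ÷-harmonic m k (*-cancelʳ-< 2 (X / 2) (2 ^ k) (≤-<-trans (m/n*n≤m X 2) (<-≤-trans X<2^[1+k] (≤-reflexive (*-comm 2 (2 ^ k))))))) ⟩
  m + m * k                                                    ≡⟨ *-suc m k ⟨
  m * suc k                                                    ∎
  where
  open ≤-Reasoning
  pair : ∀ i → m ÷ (suc i * 2) + m ÷ (1 + suc i * 2) ≤ m ÷ suc i
  pair i = ≤-trans (+-monoʳ-≤ (m ÷ (suc i * 2)) (÷-anti m {suc i * 2} (s≤s z≤n) (n≤1+n _)))
             (≤-trans (≤-reflexive (cong (λ z → m ÷ z + m ÷ z) (*-comm (suc i) 2))) (2[m÷2n]≤m÷n m (suc i)))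

n<2^[1+⌊log₂n⌋] : ∀ n → n < 2 ^ suc ⌊log₂ n ⌋
n<2^[1+⌊log₂n⌋] n = ≰⇒> λ 2^≤n → 1+n≰n (≤-trans (≤-reflexive (sym (⌊log₂[2^n]⌋≡n (suc ⌊log₂ n ⌋)))) (⌊log₂⌋-mono-≤ 2^≤n))

2^⌊log₂n⌋≤n : ∀ n → 1 ≤ n → 2 ^ ⌊log₂ n ⌋ ≤ n
2^⌊log₂n⌋≤n = <-rec (λ n → 1 ≤ n → 2 ^ ⌊log₂ n ⌋ ≤ n) step
  where
  open ≤-Reasoning
  step : ∀ n → (∀ {m} → m < n → 1 ≤ m → 2 ^ ⌊log₂ m ⌋ ≤ m) → 1 ≤ n → 2 ^ ⌊log₂ n ⌋ ≤ n
  step 1               _   _ = ≤-refl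
  step n@(suc (suc k)) rec _ = begin
    2 ^ ⌊log₂ n ⌋              ≤⟨ ^-monoʳ-≤ 2 (≤-trans (m≤n+m∸n ⌊log₂ n ⌋ 1) (≤-reflexive (cong suc (sym (⌊log₂⌊n/2⌋⌋≡⌊log₂n⌋∸1 n))))) ⟩
    2 ^ suc ⌊log₂ ⌊ n /2⌋ ⌋    ≤⟨ *-monoʳ-≤ 2 (rec (⌊n/2⌋<n (suc k)) (s≤s z≤n)) ⟩
    2 * ⌊ n /2⌋                ≡⟨ cong (⌊ n /2⌋ +_) (+-identityʳ ⌊ n /2⌋) ⟩
    ⌊ n /2⌋ + ⌊ n /2⌋          ≤⟨ +-monoʳ-≤ ⌊ n /2⌋ (⌊n/2⌋≤⌈n/2⌉ n) ⟩
    ⌊ n /2⌋ + ⌈ n /2⌉          ≡⟨ ⌊n/2⌋+⌈n/2⌉≡n n ⟩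
    n                          ∎

n<2^n : ∀ n → n < 2 ^ n
n<2^n zero    = s≤s z≤n
n<2^n (suc n) = ≤-trans (+-mono-≤ (m^n>0 2 n) (n<2^n n)) (≤-reflexive (cong (2 ^ n +_) (sym (+-identityʳ (2 ^ n)))))

-- From n + 1 ≤ 9 (1 + ⌊n/9⌋) ≤ 9 * 2^(n/9). For n = ⌊log₂ M⌋ the ninth power of a logarithm thus
-- costs one factor M.
[1+n]^9≤9^9*2^n : ∀ n → suc n ^ 9 ≤ 9 ^ 9 * 2 ^ n
[1+n]^9≤9^9*2^n n = begin
  suc n ^ 9                   ≤⟨ ^-monoˡ-≤ 9 (m<[1+m/n]*n n 9) ⟩
  (suc (n / 9) * 9) ^ 9       ≤⟨ ^-monoˡ-≤ 9 (*-monoˡ-≤ 9 (n<2^n (n / 9))) ⟩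
  (2 ^ (n / 9) * 9) ^ 9       ≡⟨ cong (_^ 9) (*-comm (2 ^ (n / 9)) 9) ⟩
  (9 * 2 ^ (n / 9)) ^ 9       ≡⟨ ^-distribʳ-* 9 9 (2 ^ (n / 9)) ⟩
  9 ^ 9 * (2 ^ (n / 9)) ^ 9   ≡⟨ cong (9 ^ 9 *_) (^-*-assoc 2 (n / 9) 9) ⟩
  9 ^ 9 * 2 ^ (n / 9 * 9)     ≤⟨ *-monoʳ-≤ (9 ^ 9) (^-monoʳ-≤ 2 (m/n*n≤m n 9)) ⟩
  9 ^ 9 * 2 ^ n               ∎
  where open ≤-Reasoning

-- In M^11 = M^9 * M^2 the two spare factors M absorb two ninth powers of the logarithm, at the
-- price 81^9. The rounding of the root doubles 81 to 162.
MlogM²≤g : ∀ {M} → 1 ≤ M → M * suc ⌊log₂ M ⌋ ^ 2 ≤ 162 * g M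
MlogM²≤g {M} 1≤M = ≤-trans (^-cancelˡ-≤ 9 (begin
  (M * l ^ 2) ^ 9                    ≡⟨ ^-distribʳ-* 9 M (l ^ 2) ⟩
  M ^ 9 * (l ^ 2) ^ 9                ≡⟨ cong (M ^ 9 *_) (trans (^-*-assoc l 2 9) (sym (^-*-assoc l 9 2))) ⟩
  M ^ 9 * (l ^ 9) ^ 2                ≤⟨ *-monoʳ-≤ (M ^ 9) (^-monoˡ-≤ 2 (≤-trans ([1+n]^9≤9^9*2^n ⌊log₂ M ⌋) (*-monoʳ-≤ (9 ^ 9) (2^⌊log₂n⌋≤n M 1≤M)))) ⟩
  M ^ 9 * (9 ^ 9 * M) ^ 2            ≡⟨ cong (M ^ 9 *_) (^-distribʳ-* 2 (9 ^ 9) M) ⟩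
  M ^ 9 * (81 ^ 9 * M ^ 2)           ≡⟨ trans (x*[y*z] (M ^ 9) (81 ^ 9) (M ^ 2)) (cong (81 ^ 9 *_) (sym (^-distribˡ-+-* M 9 2))) ⟩
  81 ^ 9 * M ^ 11                    ≤⟨ *-monoʳ-≤ (81 ^ 9) (≤-trans (m≤n*m (M ^ 11) (D ^ 9) {{m^n≢0 D 9 {{>-nonZero (<⇒≤ 2≤D)}}}}) (<⇒≤ (root-upper 9 (D ^ 9 * M ^ 11)))) ⟩
  81 ^ 9 * suc (g M) ^ 9             ≡⟨ ^-distribʳ-* 9 81 (suc (g M)) ⟨
  (81 * suc (g M)) ^ 9               ∎))
  (≤-trans (*-monoʳ-≤ 81 (+-monoˡ-≤ (g M) (≤-trans (s≤s z≤n) (1+X≤g 1≤M)))) (≤-reflexive (rearrange (g M))))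
  where
  open ≤-Reasoning
  l = suc ⌊log₂ M ⌋
  x*[y*z] : ∀ x y z → x * (y * z) ≡ y * (x * z)
  x*[y*z] = solve-∀
  rearrange : ∀ x → 81 * (x + x) ≡ 162 * x
  rearrange = solve-∀

g-growth : ∀ {p q} .{{_ : NonZero q}} (f : (M : ℕ) → .{{NonZero M}} → ℕ) C → 11 * q ≤ p * 9 →
           (∀ M .{{_ : NonZero M}} → f M ≤ C * g M) → f ∈O[N^ p / q ]
g-growth {p} {q} f C 11q≤9p f≤Cg = C * D , 1 , λ M 1≤M → ^-cancelˡ-≤ 9 (begin
  (f M ^ q) ^ 9                          ≡⟨ exponents (f M) q 9 ⟩
  (f M ^ 9) ^ q                          ≤⟨ ^-monoˡ-≤ q (^-monoˡ-≤ 9 (f≤Cg M)) ⟩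
  ((C * g M) ^ 9) ^ q                    ≡⟨ cong (_^ q) (^-distribʳ-* 9 C (g M)) ⟩
  (C ^ 9 * g M ^ 9) ^ q                  ≤⟨ ^-monoˡ-≤ q (*-monoʳ-≤ (C ^ 9) (root-lower 9 (D ^ 9 * M ^ 11))) ⟩
  (C ^ 9 * (D ^ 9 * M ^ 11)) ^ q         ≡⟨ cong (_^ q) (trans (sym (*-assoc (C ^ 9) (D ^ 9) (M ^ 11))) (cong (_* M ^ 11) (sym (^-distribʳ-* 9 C D)))) ⟩
  ((C * D) ^ 9 * M ^ 11) ^ q             ≡⟨ ^-distribʳ-* q ((C * D) ^ 9) (M ^ 11) ⟩
  ((C * D) ^ 9) ^ q * (M ^ 11) ^ q       ≡⟨ cong₂ _*_ (exponents (C * D) 9 q) (^-*-assoc M 11 q) ⟩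
  ((C * D) ^ q) ^ 9 * M ^ (11 * q)       ≤⟨ *-monoʳ-≤ (((C * D) ^ q) ^ 9) (^-monoʳ-≤ M {{>-nonZero 1≤M}} 11q≤9p) ⟩
  ((C * D) ^ q) ^ 9 * M ^ (p * 9)        ≡⟨ cong (((C * D) ^ q) ^ 9 *_) (^-*-assoc M p 9) ⟨
  ((C * D) ^ q) ^ 9 * (M ^ p) ^ 9        ≡⟨ ^-distribʳ-* 9 ((C * D) ^ q) (M ^ p) ⟨
  ((C * D) ^ q * M ^ p) ^ 9              ∎)
  where
  open ≤-Reasoning
  exponents : ∀ x a b → (x ^ a) ^ b ≡ (x ^ b) ^ a
  exponents x a b = trans (^-*-assoc x a b) (trans (cong (x ^_) (*-comm a b)) (sym (^-*-assoc x b a)))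

open Defs using (N; n; m; k; T; t; u; kMax; kTop; E₁; E₂; arg; new; old; bound)

-- Total correctness triples with bounds on time and space

reg : ∀ {M} → State M → Reg → ℕ
reg σ r = lookup (registers σ) r

-- With all fifteen registers exposed, reads and updates at fixed registers compute, and most frame
-- conditions hold by `refl`.
pattern cells a b c d e f g h i j k l m n o C =
  state (a ∷ b ∷ c ∷ d ∷ e ∷ f ∷ g ∷ h ∷ i ∷ j ∷ k ∷ l ∷ m ∷ n ∷ o ∷ []) C

byCells : ∀ {M} {P : State M → Set} →
          (∀ {a b c d e f g h i j k l m n o} C → P (cells a b c d e f g h i j k l m n o C)) → ∀ σ → P σ
byCells p (cells _ _ _ _ _ _ _ _ _ _ _ _ _ _ _ C) = p C

holds? : ∀ {M} (σ : State M) b → Dec (Holds σ b)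
holds? σ (x ≺ y) = ⟦ x ⟧ σ <? ⟦ y ⟧ σ
holds? σ (x ≼ y) = ⟦ x ⟧ σ ≤? ⟦ y ⟧ σ

sum-bits-≤ : ∀ {k B} (xs : Vec ℕ k) → (∀ i → lookup xs i ≤ B) → Vec.sum (Vec.map bits xs) ≤ k * bits B
sum-bits-≤ []       _    = z≤n
sum-bits-≤ (x ∷ xs) xs≤B = +-mono-≤ (s≤s (⌊log₂⌋-mono-≤ (xs≤B Fin.zero))) (sum-bits-≤ xs (λ i → xs≤B (Fin.suc i)))

maximum-bits-≤ : ∀ {k w} (xs : Vec ℕ k) → (∀ i → lookup xs i ≤ w) → maximum (Vec.map bits xs) ≤ bits w
maximum-bits-≤ []       _    = z≤n
maximum-bits-≤ (x ∷ xs) xs≤w = ⊔-lub (s≤s (⌊log₂⌋-mono-≤ (xs≤w Fin.zero))) (maximum-bits-≤ xs (λ i → xs≤w (Fin.suc i)))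

lookup-update-≤ : ∀ {k b v} (xs : Vec ℕ k) j → (∀ i → lookup xs i ≤ b) → v ≤ b → ∀ i → lookup (xs [ j ]≔ v) i ≤ b
lookup-update-≤ {v = v} xs j xs≤b v≤b i with i ≟ᶠ j
... | yes refl = ≤-trans (≤-reflexive (lookup∘update i xs v)) v≤b
... | no  i≢j  = ≤-trans (≤-reflexive (lookup∘update′ i≢j xs v)) (xs≤b i)

module Triples (M B w : ℕ) where

  record Bounded (σ : State M) : Set where
    field
      regs≤    : ∀ r → reg σ r ≤ B
      entries≤ : ∀ i → lookup (compl σ) i ≤ w

  open Bounded public

  spaceBound : ℕ
  spaceBound = #registers * bits B + M * bits w

  space-≤ : ∀ {σ} → Bounded σ → space σ ≤ spaceBound
  space-≤ {σ} bd = +-mono-≤ (sum-bits-≤ (registers σ) (regs≤ bd)) (*-monoʳ-≤ M (maximum-bits-≤ (compl σ) (entries≤ bd)))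

  setReg-bounded : ∀ {σ r v} → Bounded σ → v ≤ B → Bounded (setReg r v σ)
  setReg-bounded {σ} {r} bd v≤B = record
    { regs≤ = lookup-update-≤ (registers σ) r (regs≤ bd) v≤B ; entries≤ = entries≤ bd }

  setCompl-bounded : ∀ {σ i v} → Bounded σ → v ≤ w → Bounded (setCompl i v σ)
  setCompl-bounded {σ} {i} bd v≤w = record
    { regs≤ = regs≤ bd ; entries≤ = lookup-update-≤ (compl σ) i (entries≤ bd) v≤w }

  -- A triple contains a terminating execution. Peak space refers to all states passed through, so
  -- `Bounded` is carried along at every command.
  record Triple (c : Cmd) (σ : State M) (τ : ℕ) (Q : State M → Set) : Set where
    field
      {final}     : State M
      {steps}     : ℕ
      {peak}      : ℕ
      computation : ⟨ c , σ ⟩⇓⟨ final , steps , peak ⟩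
      steps≤      : steps ≤ τ
      peak≤       : peak ≤ spaceBound
      bounded     : Bounded final
      post        : Q final

  open Triple public

  weaken : ∀ {c σ τ τ′ Q} → τ ≤ τ′ → Triple c σ τ Q → Triple c σ τ′ Q
  weaken τ≤τ′ p = record
    { computation = computation p ; steps≤ = ≤-trans (steps≤ p) τ≤τ′ ; peak≤ = peak≤ p ; bounded = bounded p ; post = post p }

  consequence : ∀ {c σ τ Q Q′} → Triple c σ τ Q → (∀ σ′ → Q σ′ → Q′ σ′) → Triple c σ τ Q′
  consequence p Q⇒Q′ = record
    { computation = computation p ; steps≤ = steps≤ p ; peak≤ = peak≤ p ; bounded = bounded p ; post = Q⇒Q′ _ (post p) }

  bind : ∀ {c₁ c₂ σ τ₁ τ₂ Q₁ Q} → Triple c₁ σ τ₁ Q₁ →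
         (∀ σ′ → Bounded σ′ → Q₁ σ′ → Triple c₂ σ′ τ₂ Q) → Triple (c₁ ⨟ c₂) σ (τ₁ + τ₂) Q
  bind p f with q ← f _ (bounded p) (post p) = record
    { computation = seq (computation p) (computation q)
    ; steps≤ = +-mono-≤ (steps≤ p) (steps≤ q) ; peak≤ = ⊔-lub (peak≤ p) (peak≤ q) ; bounded = bounded q ; post = post q }

  put : ∀ {r e v σ Q} → Bounded σ → σ ⊢ e ⇓ v → v ≤ B → Q (setReg r v σ) → Triple (r ≔ e) σ 1 Q
  put {r} {σ = σ} bd ev v≤B q = record
    { computation = assign ev ; steps≤ = ≤-refl ; peak≤ = ⊔-lub (space-≤ bd) (space-≤ bd′) ; bounded = bd′ ; post = q }
    where bd′ = setReg-bounded {σ} {r} bd v≤B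

  put-then : ∀ {r e v σ c τ Q} → Bounded σ → σ ⊢ e ⇓ v → v ≤ B →
             (Bounded (setReg r v σ) → Triple c (setReg r v σ) τ Q) → Triple (r ≔ e ⨟ c) σ (suc τ) Q
  put-then {r} {v = v} {σ = σ} bd ev v≤B f = bind (put {Q = _≡ setReg r v σ} bd ev v≤B refl) λ { _ bd′ refl → f bd′ }

  store : ∀ {x y σ Q} → Bounded σ → ∀ i → ⟦ x ⟧ σ ≡ suc (toℕ i) → ⟦ y ⟧ σ ≤ w → Q (setCompl i (⟦ y ⟧ σ) σ) →
          Triple (Compl[ x ]≔ y) σ 1 Q
  store {y = y} {σ = σ} bd i eq y≤w q = record
    { computation = write eq ; steps≤ = ≤-refl ; peak≤ = ⊔-lub (space-≤ bd) (space-≤ bd′) ; bounded = bd′ ; post = q }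
    where bd′ = setCompl-bounded {σ} {i} bd y≤w

  when : ∀ {b c σ τ Q} → Bounded σ → (Holds σ b → Triple c σ τ Q) → (¬ Holds σ b → Q σ) → Triple (if b then c) σ (suc τ) Q
  when {b} {σ = σ} bd true false with holds? σ b
  ... | yes h = let p = true h in record
    { computation = enter h (computation p) ; steps≤ = s≤s (steps≤ p) ; peak≤ = peak≤ p ; bounded = bounded p ; post = post p }
  ... | no ¬h = record
    { computation = skip ¬h ; steps≤ = s≤s z≤n ; peak≤ = space-≤ bd ; bounded = bd ; post = false ¬h }

  -- I k is the loop invariant when at most k further iterations follow.
  repeat : ∀ {b c} (I : ℕ → State M → Set) (cost : ℕ → ℕ) →
           (∀ {k} σ → Bounded σ → I k σ → Holds σ b → ∃[ j ] k ≡ suc j × Triple c σ (cost j) (I j)) →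
           ∀ k {σ} → Bounded σ → I k σ →
           Triple (while b loop c) σ (suc (Σ< k (λ j → suc (cost j)))) (λ σ′ → ¬ Holds σ′ b × ∃[ j ] I j σ′)
  repeat {b} I cost body k {σ} bd inv with holds? σ b
  ... | no ¬h = record
    { computation = stop ¬h ; steps≤ = s≤s z≤n ; peak≤ = space-≤ bd ; bounded = bd ; post = ¬h , k , inv }
  ... | yes h with body σ bd inv h
  ...   | j , refl , p with q ← repeat I cost body j (bounded p) (post p) = record
    { computation = loop h (computation p) (computation q)
    ; steps≤ = s≤s (≤-trans (+-mono-≤ (steps≤ p) (steps≤ q))
                 (≤-reflexive (trans (+-suc (cost j) _) (+-comm (suc (cost j)) (Σ< j (λ i → suc (cost i)))))))
    ; peak≤ = ⊔-lub (peak≤ p) (peak≤ q) ; bounded = bounded q ; post = post q }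

reg-set : ∀ {M} (σ : State M) r v → reg (setReg r v σ) r ≡ v
reg-set σ r v = lookup∘update r (registers σ) v

reg-keep : ∀ {M} (σ : State M) {r r′} v → r′ ≢ r → reg (setReg r v σ) r′ ≡ reg σ r′
reg-keep σ v r′≢r = lookup∘update′ r′≢r (registers σ) v

E-∸3 : ∀ {x} → 4 < x → E x ≡ 3 * E (x ∸ 3)
E-∸3 4<x with k , refl ← m≤n⇒∃[o]m+o≡n 4<x = refl

E[n]≡n : ∀ {n} → 1 ≤ n → n ≤ 4 → E n ≡ n
E[n]≡n {1} _ _ = refl
E[n]≡n {2} _ _ = refl
E[n]≡n {3} _ _ = refl
E[n]≡n {4} _ _ = refl
E[n]≡n {suc (suc (suc (suc (suc n))))} _ (s≤s (s≤s (s≤s (s≤s ()))))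

-- Size bounds, and the subroutines for `E` and for taking minima.

module Specifications (M l : ℕ) (1≤M : 1 ≤ M) (M<2^[1+l] : M < 2 ^ suc l) where

  opaque

    -- `w` bounds the array entries and `B` the registers. Since M³ < 2^w and E(w) ≤ 2^w, all of M³
    -- and E(t) + E(T - t) fit below `B`. Registers then take O(log M) bits and entries O(log log
    -- M).
    w B : ℕ
    w = 3 + 3 * l
    B = 2 ^ suc w

    w≡3+3l : w ≡ 3 + 3 * l
    w≡3+3l = refl

    B≡2^[1+w] : B ≡ 2 ^ suc w
    B≡2^[1+w] = refl

    double-≤B : ∀ {x} → x ≤ 2 ^ w → x + x ≤ B
    double-≤B x≤ = ≤-trans (+-mono-≤ x≤ x≤) (≤-reflexive (cong (2 ^ w +_) (sym (+-identityʳ (2 ^ w)))))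

    M³<2^w : M * M * M < 2 ^ w
    M³<2^w = begin-strict
      M * M * M              ≡⟨ rearrange M ⟩
      M ^ 3                  <⟨ ^-monoˡ-< 3 M<2^[1+l] ⟩
      (2 ^ suc l) ^ 3        ≡⟨ ^-*-assoc 2 (suc l) 3 ⟩
      2 ^ (suc l * 3)        ≡⟨ cong (2 ^_) (trans (*-comm (suc l) 3) (*-suc 3 l)) ⟩
      2 ^ (3 + 3 * l)        ∎
      where
      open ≤-Reasoning
      rearrange : ∀ x → x * x * x ≡ x * (x * (x * 1))
      rearrange = solve-∀

    3≤w : 3 ≤ w
    3≤w = m≤m+n 3 (3 * l)

  open Triples M B w public

  2w≤B : w + w ≤ B
  2w≤B = double-≤B (<⇒≤ (n<2^n w))

  w≤B : w ≤ B
  w≤B = ≤-trans (m≤m+n w w) 2w≤B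

  6≤B : 6 ≤ B
  6≤B = ≤-trans (+-mono-≤ 3≤w 3≤w) 2w≤B

  1+w≤B : suc w ≤ B
  1+w≤B = ≤-trans (+-monoˡ-≤ w (≤-trans (s≤s z≤n) 3≤w)) 2w≤B

  1≤B : 1 ≤ B
  1≤B = ≤-trans (s≤s z≤n) 6≤B

  2^w≤B : 2 ^ w ≤ B
  2^w≤B = ≤-trans (m≤m+n (2 ^ w) (2 ^ w)) (double-≤B ≤-refl)

  M²≤B : M * M ≤ B
  M²≤B = ≤-trans (m≤m*n (M * M) M {{>-nonZero 1≤M}}) (≤-trans (<⇒≤ M³<2^w) 2^w≤B)

  M³≤B : M * M * M ≤ B
  M³≤B = ≤-trans (<⇒≤ M³<2^w) 2^w≤B

  M≤B : M ≤ B
  M≤B = ≤-trans (m≤m*n M M {{>-nonZero 1≤M}}) M²≤B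

  1+M≤B : suc M ≤ B
  1+M≤B = ≤-trans (s≤s (≤-trans (m≤m*n M M {{>-nonZero 1≤M}}) (m≤m*n (M * M) M {{>-nonZero 1≤M}}))) (≤-trans M³<2^w 2^w≤B)

  E+E≤B : ∀ {x y} → x ≤ w → y ≤ w → E x + E y ≤ B
  E+E≤B {x} {y} x≤w y≤w = ≤-trans (+-mono-≤ (E-mono-≤ x≤w) (E-mono-≤ y≤w)) (double-≤B (E[n]≤2^n w))

  E≤B : ∀ {x} → x ≤ w → E x ≤ B
  E≤B {x} x≤w = ≤-trans (m≤m+n (E x) (E x)) (E+E≤B x≤w x≤w)

  Eτ : ℕ
  Eτ = 5 + 3 * w

  -- The loop keeps the partial result times E(arg) equal to E of the argument, with arg ≥ 1. It
  -- exits with arg ≤ 4, where E(arg) = arg. The argument itself is a crude bound for the number of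
  -- passes.
  computeE : ∀ r a σ → r ≢ arg → a ≢ r → Bounded σ → reg σ a ≤ w →
             Triple (r ≔E a) σ Eτ (λ σ′ → reg σ′ r ≡ E (reg σ a)
               × (∀ r′ → r′ ≢ r → r′ ≢ arg → reg σ′ r′ ≡ reg σ r′) × compl σ′ ≡ compl σ)
  computeE r a σ r≢arg a≢r bd x≤w =
    put-then bd copy 1≤B λ bd₁ → put-then bd₁ copy (regs≤ bd₁ a) λ bd₂ →
    when bd₂
      (λ h → weaken loop-cost (bind
        (repeat I (λ _ → 2) body x {σ₂} bd₂
          (≤-reflexive arg₂ , h , trans (cong₂ (λ y z → y * E z) r₂ arg₂) (*-identityˡ (E x)) , keep₂ , refl))
        λ σ′ bd′ (¬h , _ , _ , 1≤arg , eq , keep , c) →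
          let result = trans (cong (reg σ′ r *_) (sym (E[n]≡n 1≤arg (≮⇒≥ ¬h)))) eq in
          put bd′ mul (≤-trans (≤-reflexive result) (E≤B x≤w))
            (trans (reg-set σ′ r _) result , (λ r′ p q → trans (reg-keep σ′ _ p) (keep r′ p q)) , c)))
      (λ ¬h → trans r₂ (cong E (sym (n≤0⇒n≡0 (≤-trans (≤-reflexive (sym arg₂)) (≮⇒≥ ¬h))))) , keep₂ , refl)
    where
    x = reg σ a
    σ₁ = setReg r 1 σ
    σ₂ = setReg arg (reg σ₁ a) σ₁
    arg₂ : reg σ₂ arg ≡ x
    arg₂ = trans (reg-set σ₁ arg _) (reg-keep σ 1 a≢r)
    r₂ : reg σ₂ r ≡ 1
    r₂ = trans (reg-keep σ₁ _ r≢arg) (reg-set σ r 1)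
    keep₂ : ∀ r′ → r′ ≢ r → r′ ≢ arg → reg σ₂ r′ ≡ reg σ r′
    keep₂ r′ p q = trans (reg-keep σ₁ _ q) (reg-keep σ 1 p)
    I : ℕ → State M → Set
    I k σ′ = reg σ′ arg ≤ k × 1 ≤ reg σ′ arg × reg σ′ r * E (reg σ′ arg) ≡ E x
           × (∀ r′ → r′ ≢ r → r′ ≢ arg → reg σ′ r′ ≡ reg σ r′) × compl σ′ ≡ compl σ
    loop-cost : suc (Σ< x (λ _ → 3)) + 1 ≤ 2 + 3 * w
    loop-cost = ≤-trans (≤-reflexive (trans (+-comm (suc (Σ< x (λ _ → 3))) 1) (cong (2 +_) (Σ<-const x 3))))
      (+-monoʳ-≤ 2 (≤-trans (*-monoˡ-≤ 3 x≤w) (≤-reflexive (*-comm w 3))))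
    body : ∀ {k} σ′ → Bounded σ′ → I k σ′ → Holds σ′ (# 4 ≺ $ arg) →
           ∃[ j ] k ≡ suc j × Triple (r ≔ $ r ⊗ # 3 ⨟ arg ≔ $ arg ⊖ # 3) σ′ 2 (I j)
    body {zero}  σ′ bd (arg≤ , 1≤arg , _) h = contradiction (≤-trans 1≤arg arg≤) λ ()
    body {suc k} σ′ bd (arg≤ , 1≤arg , eq , keep , c) h = k , refl ,
      (put-then bd mul (≤-trans (*-monoʳ-≤ (reg σ′ r) 3≤E) (≤-trans (≤-reflexive eq) (E≤B x≤w))) λ bd₃ →
       put bd₃ (sub (≤-trans (<⇒≤ (<⇒≤ h)) (≤-reflexive (sym arg₃)))) (≤-trans (m∸n≤m (reg σ₃ arg) 3) (regs≤ bd₃ arg))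
         ( ≤-trans (≤-reflexive arg₄) (≤-trans (∸-monoˡ-≤ 3 arg≤) (m∸n≤m k 2))
         , ≤-trans (m<n⇒0<n∸m (<⇒≤ h)) (≤-reflexive (sym arg₄))
         , trans (cong₂ (λ y z → y * E z) (trans (reg-keep σ₃ _ r≢arg) (reg-set σ′ r _)) arg₄)
             (trans (*-assoc (reg σ′ r) 3 _) (trans (cong (reg σ′ r *_) (sym (E-∸3 h))) eq))
         , (λ r′ p q → trans (reg-keep σ₃ _ q) (trans (reg-keep σ′ _ p) (keep r′ p q)))
         , c ))
      where
      σ₃ = setReg r (reg σ′ r * 3) σ′
      arg₃ : reg σ₃ arg ≡ reg σ′ arg
      arg₃ = reg-keep σ′ _ (λ eq → r≢arg (sym eq))
      arg₄ : reg (setReg arg (reg σ₃ arg ∸ 3) σ₃) arg ≡ reg σ′ arg ∸ 3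
      arg₄ = trans (reg-set σ₃ arg _) (cong (_∸ 3) arg₃)
      3≤E : 3 ≤ E (reg σ′ arg)
      3≤E = ≤-trans (*-monoʳ-≤ 3 (1≤E (reg σ′ arg ∸ 3))) (≤-reflexive (sym (E-∸3 h)))

  infix 4 _⊑_

  -- After initialisation all writes go through `improve`, so entries only decrease and every upper
  -- bound, once established, survives.
  _⊑_ : Vec ℕ M → Vec ℕ M → Set
  C′ ⊑ C = ∀ i → lookup C′ i ≤ lookup C i

  ⊑-refl : ∀ {C} → C ⊑ C
  ⊑-refl i = ≤-refl

  Sound : Vec ℕ M → Set
  Sound C = ∀ i → ‖ suc (toℕ i) ‖ ≤ lookup C i

  -- Quantifying over indices makes the bound vacuous outside the array, in particular at products
  -- beyond M.
  Upper : Vec ℕ M → ℕ → ℕ → Set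
  Upper C x c = ∀ i → suc (toℕ i) ≡ x → lookup C i ≤ c

  Exact : Vec ℕ M → ℕ → Set
  Exact C x = ∀ i → suc (toℕ i) < x → lookup C i ≤ ‖ suc (toℕ i) ‖

  -- The trace left by step (4), ordered by the larger factor b: the product a * b is offered to the
  -- array when n = b.
  Products : Vec ℕ M → ℕ → Set
  Products C x = ∀ {a b} → 2 ≤ a → a ≤ b → b < x → Upper C (a * b) (‖ a ‖ + ‖ b ‖)

  index : ∀ {x} → 1 ≤ x → x ≤ M → Σ[ i ∈ Fin M ] x ≡ suc (toℕ i)
  index {suc x} _ x<M = fromℕ< x<M , cong suc (sym (toℕ-fromℕ< x<M))

  lookup-exact : ∀ C {x} → Sound C → Exact C x → ∀ i → suc (toℕ i) < x → lookup C i ≡ ‖ suc (toℕ i) ‖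
  lookup-exact C sound exact i i<x = ≤-antisym (exact i i<x) (sound i)

  improve-spec : ∀ ρ σ i → ρ ≢ old → Bounded σ → reg σ ρ ≡ suc (toℕ i) → ‖ suc (toℕ i) ‖ ≤ reg σ new → Sound (compl σ) →
                 Triple (improve ρ) σ 3 (λ σ′ → (∀ r → r ≢ old → reg σ′ r ≡ reg σ r)
                   × compl σ′ ⊑ compl σ × Sound (compl σ′) × Upper (compl σ′) (suc (toℕ i)) (reg σ new))
  improve-spec ρ σ i ρ≢old bd at-i lower sound =
    put-then bd (read at-i) (≤-trans (entries≤ bd i) w≤B) λ bd₁ →
    when bd₁
      (λ h → store bd₁ i (trans (reg-keep σ _ ρ≢old) at-i) (≤-trans (≤-reflexive new₁) (≤-trans (<⇒≤ (new<C h)) (entries≤ bd i)))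
        ( (λ r p → reg-keep σ _ p)
        , (λ j → [ (λ { (refl , eq) → ≤-trans (≤-reflexive eq) (<⇒≤ (new<C h)) }) , (λ eq → ≤-reflexive eq) ]′ (cases j))
        , (λ j → [ (λ { (refl , eq) → ≤-trans lower (≤-reflexive (sym eq)) }) , (λ eq → ≤-trans (sound j) (≤-reflexive (sym eq))) ]′ (cases j))
        , (λ { j j≡i → ≤-reflexive (at-j j j≡i) }) ))
      (λ ¬h → (λ r p → reg-keep σ _ p) , ⊑-refl {compl σ} , sound ,
        (λ { j j≡i → subst (λ j → lookup (compl σ) j ≤ reg σ new) (toℕ-injective (sym (suc-injective j≡i))) (C≤new ¬h) }))
    where
    σ₁ = setReg old (lookup (compl σ) i) σ
    new₁ : reg σ₁ new ≡ reg σ new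
    new₁ = reg-keep σ _ (λ ())
    new<C : reg σ₁ new < reg σ₁ old → reg σ new < lookup (compl σ) i
    new<C h = subst₂ _<_ new₁ (reg-set σ old _) h
    C≤new : ¬ (reg σ₁ new < reg σ₁ old) → lookup (compl σ) i ≤ reg σ new
    C≤new ¬h = subst₂ _≤_ (reg-set σ old _) new₁ (≮⇒≥ ¬h)
    C′ = compl σ [ i ]≔ reg σ₁ new
    cases : ∀ j → (j ≡ i × lookup C′ j ≡ reg σ new) ⊎ lookup C′ j ≡ lookup (compl σ) j
    cases j with j ≟ᶠ i
    ... | yes refl = inj₁ (refl , trans (lookup∘update i (compl σ) _) new₁)
    ... | no  j≢i  = inj₂ (lookup∘update′ j≢i (compl σ) _)
    at-j : ∀ j → suc (toℕ j) ≡ suc (toℕ i) → lookup C′ j ≡ reg σ new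
    at-j j j≡i with refl ← toℕ-injective (suc-injective j≡i) = trans (lookup∘update i (compl σ) _) new₁

-- Steps (1) and (2).

module Phases (M l : ℕ) (1≤M : 1 ≤ M) (M<2^[1+l] : M < 2 ^ suc l) where

  open Specifications M l 1≤M M<2^[1+l]

  Stage : Vec ℕ M → ℕ → State M → Set
  Stage C₀ ν σ = reg σ N ≡ M × reg σ n ≡ ν × compl σ ⊑ C₀ × Sound (compl σ)

  exact-⊑ : ∀ C C₀ {x} → Exact C₀ x → C ⊑ C₀ → Exact C x
  exact-⊑ C C₀ exact C⊑C₀ i i<x = ≤-trans (C⊑C₀ i) (exact i i<x)

  upper-⊑ : ∀ C C₀ {x c} → Upper C₀ x c → C ⊑ C₀ → Upper C x c
  upper-⊑ C C₀ upper C⊑C₀ i i≡x = ≤-trans (C⊑C₀ i) (upper i i≡x)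

  read-exact : ∀ C {x y} → Sound C → Exact C x → 1 ≤ y → y < x → y ≤ M →
               Σ[ i ∈ Fin M ] y ≡ suc (toℕ i) × lookup C i ≡ ‖ y ‖
  read-exact C sound exact 1≤y y<x y≤M with i , refl ← index 1≤y y≤M = i , refl , lookup-exact C sound exact i y<x

  step₁-spec : ∀ {C₀ ν} σ → Bounded σ → 1 ≤ ν → ν < M → Exact C₀ (suc ν) → Stage C₀ (suc ν) σ →
               Triple step₁ σ 6 (λ σ′ → Stage C₀ (suc ν) σ′ × Upper (compl σ′) (suc ν) (suc ‖ ν ‖))
  step₁-spec {C₀} {ν} (cells _ _ _ _ _ _ _ _ _ _ _ _ _ _ _ C) bd 1≤ν ν<M exact (refl , refl , C⊑C₀ , sound) =
      let i , ν≡ , Ci≡ = read-exact C sound (exact-⊑ C C₀ exact C⊑C₀) 1≤ν ≤-refl (<⇒≤ ν<M)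
          j , 1+ν≡ = index (s≤s z≤n) ν<M
          new≡ = trans (cong (_+ 1) Ci≡) (+-comm ‖ ν ‖ 1) in
      put-then bd (sub (s≤s z≤n)) (≤-trans (<⇒≤ ν<M) M≤B) λ bd₁ →
      put-then bd₁ (read {i = i} ν≡) (≤-trans (entries≤ bd i) w≤B) λ bd₂ →
      put-then bd₂ add (≤-trans (+-monoˡ-≤ 1 (entries≤ bd i)) (≤-trans (≤-reflexive (+-comm w 1)) 1+w≤B)) λ bd₃ →
      consequence
        (improve-spec n _ j (λ ()) bd₃ 1+ν≡ (≤-trans (≤-reflexive (cong ‖_‖ (sym 1+ν≡))) (≤-trans (‖1+n‖≤ 1≤ν) (≤-reflexive (sym new≡)))) sound)
        λ σ′ (keep , ⊑C , sound′ , upper) →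
          (keep N (λ ()) , keep n (λ ()) , (λ k → ≤-trans (⊑C k) (C⊑C₀ k)) , sound′) ,
          (λ k k≡ → ≤-trans (upper k (trans k≡ 1+ν≡)) (≤-reflexive new≡))

  evaluateτ : ℕ
  evaluateτ = suc (Eτ + (Eτ + 1))

  evaluateBound-spec : ∀ σ → Bounded σ → reg σ t ≤ reg σ T → reg σ T ≤ w →
    Triple evaluateBound σ evaluateτ (λ σ′ → reg σ′ new ≡ E (reg σ t) + E (reg σ T ∸ reg σ t)
      × reg σ′ N ≡ reg σ N × reg σ′ n ≡ reg σ n × reg σ′ T ≡ reg σ T × reg σ′ t ≡ reg σ t × compl σ′ ≡ compl σ)
  evaluateBound-spec σ@(cells _ _ _ _ Tᵥ tᵥ _ _ _ _ _ _ _ _ _ C) bd t≤T T≤w =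
    put-then bd (sub t≤T) (≤-trans (m∸n≤m Tᵥ tᵥ) (regs≤ bd T)) λ bd₁ →
    bind (computeE E₁ t σ₁ (λ ()) (λ ()) bd₁ (≤-trans t≤T T≤w)) λ σ₂ bd₂ (e₁ , keep₂ , c₂) →
    let u≡ = keep₂ u (λ ()) (λ ()) in
    bind (computeE E₂ u σ₂ (λ ()) (λ ()) bd₂ (≤-trans (≤-reflexive u≡) (≤-trans (m∸n≤m Tᵥ tᵥ) T≤w)))
    (byCells λ _ bd₃ (e₂ , keep₃ , c₃) →
      let sum≡ = cong₂ _+_ (trans (keep₃ E₁ (λ ()) (λ ())) e₁) (trans e₂ (cong E u≡)) in
      put bd₃ add (≤-trans (≤-reflexive sum≡) (E+E≤B (≤-trans t≤T T≤w) (≤-trans (m∸n≤m Tᵥ tᵥ) T≤w)))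
        ( sum≡
        , trans (keep₃ N (λ ()) (λ ())) (keep₂ N (λ ()) (λ ()))
        , trans (keep₃ n (λ ()) (λ ())) (keep₂ n (λ ()) (λ ()))
        , trans (keep₃ T (λ ()) (λ ())) (keep₂ T (λ ()) (λ ()))
        , trans (keep₃ t (λ ()) (λ ())) (keep₂ t (λ ()) (λ ()))
        , trans c₃ c₂))
    where σ₁ = setReg u (Tᵥ ∸ tᵥ) σ

  step₂τ : ℕ
  step₂τ = 3 + (evaluateτ + (suc (Σ< w (λ _ → suc (suc evaluateτ))) + Eτ))

  -- Correctness rests on `largest`, while `reachable` and `2cut≤T` limit the size of kMax. The scan
  -- descends from T/2, so the first admissible t it meets is the largest.
  record Cutoff (ν K : ℕ) : Set where
    field
      cut       : ℕ
      K≡        : K ≡ E cut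
      2cut≤T    : 2 * cut ≤ ‖ ν ‖
      reachable : suc ν ≤ E cut + E (‖ ν ‖ ∸ cut)
      largest   : ∀ {s} → 2 * s ≤ ‖ ν ‖ → suc ν ≤ E s + E (‖ ν ‖ ∸ s) → s ≤ cut

  2x≤y⇒x≤y : ∀ {x y} → 2 * x ≤ y → x ≤ y
  2x≤y⇒x≤y {x} = ≤-trans (m≤m+n x (x + 0))

  step₂-spec : ∀ {C₀ ν} σ → Bounded σ → 1 ≤ ν → ν < M → Exact C₀ (suc ν) → Stage C₀ (suc ν) σ →
               Triple step₂ σ step₂τ (λ σ′ → Cutoff ν (reg σ′ kMax) × reg σ′ N ≡ M × reg σ′ n ≡ suc ν × compl σ′ ≡ compl σ)
  step₂-spec {C₀} {ν} (cells _ _ _ _ _ _ _ _ _ _ _ _ _ _ _ C) bd 1≤ν ν<M exact (refl , refl , C⊑C₀ , sound) =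
      let i , ν≡ , Ci≡ = read-exact C sound (exact-⊑ C C₀ exact C⊑C₀) 1≤ν ≤-refl (<⇒≤ ν<M)
          T≤w = ≤-trans (≤-reflexive (sym Ci≡)) (entries≤ bd i)
          half≤ = m/n≤m (lookup C i) 2 in
      put-then bd (sub (s≤s z≤n)) (≤-trans (<⇒≤ ν<M) M≤B) λ bd₁ →
      put-then bd₁ (read {i = i} ν≡) (≤-trans (entries≤ bd i) w≤B) λ bd₂ →
      put-then bd₂ (quot refl) (≤-trans half≤ (≤-trans (entries≤ bd i) w≤B)) λ bd₃ →
      bind (evaluateBound-spec _ bd₃ half≤ (entries≤ bd i)) λ σ₄ bd₄ (new≡ , N≡ , n≡ , T≡ , t≡ , c≡) →
      bind (weaken (s≤s (Σ<-monoˡ-≤ (λ _ → suc (suc evaluateτ)) (≤-trans half≤ (entries≤ bd i))))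
        (repeat (I C) (λ _ → suc evaluateτ) (body T≤w 1≤ν) (lookup C i / 2) bd₄
        ( N≡ , n≡ , trans T≡ Ci≡ , t≡ , c≡
        , trans new≡ (cong (λ T → E (lookup C i / 2) + E (T ∸ lookup C i / 2)) Ci≡)
        , ≤-trans (≤-reflexive (*-comm 2 (lookup C i / 2))) (≤-trans (m/n*n≤m (lookup C i) 2) (≤-reflexive Ci≡))
        , λ {s} 2s≤T _ → ≤-trans (≤-reflexive (sym (m*n/n≡m s 2)))
            (/-monoˡ-≤ 2 (≤-trans (≤-reflexive (*-comm s 2)) (≤-trans 2s≤T (≤-reflexive (sym Ci≡))))) )))
      λ σ₅ bd₅ (¬h , k , N≡ , n≡ , T≡ , t≡ , c≡ , new≡ , 2k≤T , largest) →
      consequence (computeE kMax t σ₅ (λ ()) (λ ()) bd₅ (≤-trans (≤-reflexive t≡) (≤-trans (2x≤y⇒x≤y 2k≤T) T≤w)))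
      λ σ₆ (e , keep , c) →
        record { cut = k ; K≡ = trans e (cong E t≡) ; 2cut≤T = 2k≤T
               ; reachable = ≤-trans (≤-trans (≤-reflexive (sym n≡)) (≮⇒≥ ¬h)) (≤-reflexive new≡)
               ; largest = largest }
        , trans (keep N (λ ()) (λ ())) N≡ , trans (keep n (λ ()) (λ ())) n≡ , trans c c≡
    where
    I : Vec ℕ M → ℕ → State M → Set
    I C k σ = reg σ N ≡ M × reg σ n ≡ suc ν × reg σ T ≡ ‖ ν ‖ × reg σ t ≡ k × compl σ ≡ C
            × reg σ new ≡ E k + E (‖ ν ‖ ∸ k) × 2 * k ≤ ‖ ν ‖
            × (∀ {s} → 2 * s ≤ ‖ ν ‖ → suc ν ≤ E s + E (‖ ν ‖ ∸ s) → s ≤ k)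
    body : ‖ ν ‖ ≤ w → 1 ≤ ν → ∀ {C k} σ → Bounded σ → I C k σ → Holds σ ($ new ≺ $ n) →
           ∃[ j ] k ≡ suc j × Triple (t ≔ $ t ⊖ # 1 ⨟ evaluateBound) σ (suc evaluateτ) (I C j)
    -- At t = 0 the loop has stopped, since E(0) + E(T) = 1 + E(T) ≥ 1 + ν = n. So t is never
    -- decremented below 0.
    body T≤w 1≤ν {C} {zero} σ bd (_ , n≡ , _ , _ , _ , new≡ , _) h =
      contradiction (≤-trans (s≤s (n≤E[‖n‖] 1≤ν)) (≤-trans (≤-reflexive (sym new≡)) (s≤s⁻¹ (≤-trans h (≤-reflexive n≡))))) 1+n≰n
    body T≤w 1≤ν {C} {suc j} (cells _ _ _ _ _ _ _ _ _ _ _ _ _ _ _ _) bd (refl , refl , refl , refl , refl , new≡ , 2k≤T , largest) h =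
      j , refl ,
      (put-then bd (sub (s≤s z≤n)) (≤-trans (n≤1+n j) (regs≤ bd t)) λ bd₁ →
       consequence (evaluateBound-spec _ bd₁ (≤-trans (n≤1+n j) (2x≤y⇒x≤y 2k≤T)) T≤w)
       λ σ′ (new′ , N≡ , n≡ , T≡ , t≡ , c≡) →
         N≡ , n≡ , T≡ , t≡ , c≡ , new′ , ≤-trans (*-monoʳ-≤ 2 (n≤1+n j)) 2k≤T ,
         λ 2s≤T le → s≤s⁻¹ (≤∧≢⇒< (largest 2s≤T le) λ { refl →
           <⇒≱ h (≤-trans le (≤-reflexive (sym new≡))) }))

-- Steps (3) and (4).

module MainLoop (M l : ℕ) (1≤M : 1 ≤ M) (M<2^[1+l] : M < 2 ^ suc l) where

  open Specifications M l 1≤M M<2^[1+l]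
  open Phases M l 1≤M M<2^[1+l]

  step₃-spec : ∀ {C₀ ν} σ → Bounded σ → reg σ kMax ≤ ν → ν < M → Exact C₀ (suc ν) → Stage C₀ (suc ν) σ →
               Triple step₃ σ (2 + Σ< (reg σ kMax) (λ _ → 9)) (λ σ′ → Stage C₀ (suc ν) σ′
                 × (∀ {x} → 6 ≤ x → x ≤ reg σ kMax → Upper (compl σ′) (suc ν) (‖ x ‖ + ‖ suc ν ∸ x ‖)))
  step₃-spec {C₀} {ν} σ@(cells _ _ _ _ _ _ _ K _ _ _ _ _ _ _ _) bd K≤ν ν<M exact stage =
    put-then bd copy 6≤B λ bd₁ →
    consequence (repeat I (λ _ → 8) body K bd₁ (stage , refl , s≤s (m≤n+m K 5) , s≤s z≤n , λ 6≤x x<6 → contradiction x<6 (≤⇒≯ 6≤x)))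
    λ σ′ (¬h , _ , stage′ , K≡ , _ , _ , uppers) → stage′ , λ 6≤x x≤K → uppers 6≤x (≤-<-trans (≤-trans x≤K (≤-reflexive (sym K≡))) (≰⇒> ¬h))
    where
    I : ℕ → State M → Set
    I k σ = Stage C₀ (suc ν) σ × reg σ kMax ≡ K × K < reg σ m + k × 1 ≤ reg σ m
          × (∀ {x} → 6 ≤ x → x < reg σ m → Upper (compl σ) (suc ν) (‖ x ‖ + ‖ suc ν ∸ x ‖))
    body : ∀ {k} σ → Bounded σ → I k σ → Holds σ ($ m ≼ $ kMax) →
           ∃[ j ] k ≡ suc j × Triple (u ≔ $ n ⊖ $ m ⨟ new ≔ Compl[ $ m ] ⨟ old ≔ Compl[ $ u ] ⨟
                                      new ≔ $ new ⊕ $ old ⨟ improve n ⨟ m ≔ $ m ⊕ # 1) σ 8 (I j)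
    body {zero} σ bd (_ , K≡ , K<m , _) h =
      contradiction (≤-trans h (≤-reflexive K≡)) (<⇒≱ (<-≤-trans K<m (≤-reflexive (+-identityʳ _))))
    body {suc j} σ@(cells _ _ x _ _ _ _ _ _ _ _ _ _ _ _ C) bd ((refl , refl , C⊑C₀ , sound) , refl , K<m , 1≤m , uppers) h =
      -- From 1 ≤ m ≤ ν both m and n - m lie in 1..ν, where the entries are already final.
      let m≤ν = ≤-trans h K≤ν
          exactC = exact-⊑ C C₀ exact C⊑C₀
          i₁ , m≡ , C₁ = read-exact C sound exactC 1≤m (s≤s m≤ν) (≤-trans m≤ν (<⇒≤ ν<M))
          1≤n∸m = m<n⇒0<n∸m (s≤s m≤ν)
          n∸m≤ν = ∸-monoʳ-≤ (suc ν) 1≤m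
          i₂ , n∸m≡ , C₂ = read-exact C sound exactC 1≤n∸m (s≤s n∸m≤ν) (≤-trans n∸m≤ν (<⇒≤ ν<M))
          i , n≡ = index (s≤s z≤n) ν<M
          new≡ = cong₂ _+_ C₁ C₂
          n≤new = begin
            ‖ suc (toℕ i) ‖              ≡⟨ cong ‖_‖ (sym n≡) ⟩
            ‖ suc ν ‖                    ≡⟨ cong ‖_‖ (m+[n∸m]≡n (≤-trans m≤ν (n≤1+n ν))) ⟨
            ‖ x + (suc ν ∸ x) ‖          ≤⟨ ‖+‖-≤ 1≤m 1≤n∸m ⟩
            ‖ x ‖ + ‖ suc ν ∸ x ‖        ≡⟨ new≡ ⟨
            lookup C i₁ + lookup C i₂    ∎
      in j , refl ,
      (put-then bd (sub (≤-trans m≤ν (n≤1+n ν))) (≤-trans n∸m≤ν (≤-trans (<⇒≤ ν<M) M≤B)) λ bd₁ →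
       put-then bd₁ (read {i = i₁} m≡) (≤-trans (entries≤ bd i₁) w≤B) λ bd₂ →
       put-then bd₂ (read {i = i₂} n∸m≡) (≤-trans (entries≤ bd i₂) w≤B) λ bd₃ →
       put-then bd₃ add (≤-trans (+-mono-≤ (entries≤ bd i₁) (entries≤ bd i₂)) 2w≤B) λ bd₄ →
       bind (improve-spec n _ i (λ ()) bd₄ n≡ n≤new sound)
       (byCells λ C′ bd₅ (keep , C′⊑C , sound′ , upper) →
         let m′≡ = trans (cong (_+ 1) (keep m (λ ()))) (+-comm x 1) in
         put bd₅ add (≤-trans (≤-reflexive m′≡) (≤-trans (s≤s m≤ν) (≤-trans ν<M M≤B)))
           ( (keep N (λ ()) , keep n (λ ()) , (λ i → ≤-trans (C′⊑C i) (C⊑C₀ i)) , sound′)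
           , keep kMax (λ ())
           , <-≤-trans K<m (≤-reflexive (trans (+-suc x j) (cong (_+ j) (sym m′≡))))
           , ≤-trans (s≤s z≤n) (≤-reflexive (sym m′≡))
           , λ {y} 6≤y y<m′ → [ (λ y<m → upper-⊑ C′ C (uppers 6≤y y<m) C′⊑C)
                              , (λ { refl k k≡ → ≤-trans (upper k (trans k≡ n≡)) (≤-reflexive new≡) }) ]′
                              (m≤n⇒m<n∨m≡n (s≤s⁻¹ (≤-trans y<m′ (≤-reflexive m′≡)))) )))
      where open ≤-Reasoning

  step₄τ : ℕ → ℕ
  step₄τ ν = 5 + Σ< (M / suc ν) (λ _ → 9)

  -- Exactness is required up to and including n = ν + 1, so both factors k ≤ n are read at their
  -- true complexities.
  step₄-spec : ∀ {C₀ ν} σ → Bounded σ → 1 ≤ ν → ν < M → Exact C₀ (suc (suc ν)) → Stage C₀ (suc ν) σ →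
               Triple step₄ σ (step₄τ ν) (λ σ′ → Stage C₀ (suc ν) σ′
                 × (∀ {a} → 2 ≤ a → a ≤ suc ν → Upper (compl σ′) (a * suc ν) (‖ a ‖ + ‖ suc ν ‖)))
  step₄-spec {C₀} {ν} σ@(cells _ _ _ _ _ _ _ _ _ _ _ _ _ _ _ C) bd 1≤ν ν<M exact (refl , refl , C⊑C₀ , sound) =
    put-then bd (quot refl) (≤-trans (m/n≤m M (suc ν)) M≤B) λ bd₁ →
    bind (when {Q = Top} bd₁
      (λ n<q → put bd₁ copy (≤-trans ν<M M≤B)
        (refl , refl , ((λ _ → ≤-refl) , sound) , ≤-refl , <⇒≤ n<q , λ a≤n _ → a≤n))
      (λ n≮q → refl , refl , ((λ _ → ≤-refl) , sound) , ≮⇒≥ n≮q , ≤-refl , λ _ a≤q → a≤q))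
    (byCells λ { C′ bd₂ (refl , refl , (C′⊑C , sound′) , K≤n , K≤q , K-max) →
      put-then bd₂ copy (≤-trans (s≤s (s≤s z≤n)) 6≤B) λ bd₃ →
      consequence
        (weaken (s≤s (Σ<-monoˡ-≤ (λ _ → 9) K≤q))
          (repeat (I _) (λ _ → 8) (body K≤n K≤q) _ bd₃
            ((refl , refl , (λ i → ≤-trans (C′⊑C i) (C⊑C₀ i)) , sound′) , refl , s≤s (m≤n+m _ 1) , ≤-refl ,
             λ 2≤a a<2 → contradiction a<2 (≤⇒≯ 2≤a))))
        λ σ′ (¬h , _ , stage , K≡ , _ , _ , uppers) → stage , λ {a} 2≤a a≤n i i≡ →
            uppers 2≤a (≤-<-trans (≤-trans (K-max a≤n (a≤q a i i≡)) (≤-reflexive (sym K≡))) (≰⇒> ¬h)) i i≡ })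
    where
    -- A product that has an entry satisfies a n ≤ M, hence a ≤ ⌊M / n⌋: the upper limit of the loop
    -- loses nothing inside the array.
    a≤q : ∀ a (i : Fin M) → suc (toℕ i) ≡ a * suc ν → a ≤ M / suc ν
    a≤q a i i≡ = ≤-trans (≤-reflexive (sym (m*n/n≡m a (suc ν)))) (/-monoˡ-≤ (suc ν) (≤-trans (≤-reflexive (sym i≡)) (toℕ<n i)))
    Top : State M → Set
    Top σ = reg σ N ≡ M × reg σ n ≡ suc ν × (compl σ ⊑ C × Sound (compl σ))
          × reg σ kTop ≤ suc ν × reg σ kTop ≤ M / suc ν × (∀ {a} → a ≤ suc ν → a ≤ M / suc ν → a ≤ reg σ kTop)
    I : ℕ → ℕ → State M → Set
    I K j σ = Stage C₀ (suc ν) σ × reg σ kTop ≡ K × K < reg σ k + j × 2 ≤ reg σ k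
            × (∀ {a} → 2 ≤ a → a < reg σ k → Upper (compl σ) (a * suc ν) (‖ a ‖ + ‖ suc ν ‖))
    body : ∀ {K} → K ≤ suc ν → K ≤ M / suc ν → ∀ {j} σ → Bounded σ → I K j σ → Holds σ ($ k ≼ $ kTop) →
           ∃[ j′ ] j ≡ suc j′ × Triple (m ≔ $ k ⊗ $ n ⨟ new ≔ Compl[ $ k ] ⨟ old ≔ Compl[ $ n ] ⨟
                                        new ≔ $ new ⊕ $ old ⨟ improve m ⨟ k ≔ $ k ⊕ # 1) σ 8 (I K j′)
    body K≤n K≤q {zero} σ bd (_ , K≡ , K<k , _) h =
      contradiction (≤-trans h (≤-reflexive K≡)) (<⇒≱ (<-≤-trans K<k (≤-reflexive (+-identityʳ _))))
    body {K} K≤n K≤q {suc j} σ@(cells _ _ _ x _ _ _ _ _ _ _ _ _ _ _ C) bd ((refl , refl , C⊑C₀ , sound) , refl , K<k , 2≤k , uppers) h =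
      let k≤n = ≤-trans h K≤n
          kn≤M = ≤-trans (*-monoˡ-≤ (suc ν) (≤-trans h K≤q)) (m/n*n≤m M (suc ν))
          exactC = exact-⊑ C C₀ exact C⊑C₀
          i₁ , k≡ , C₁ = read-exact C sound exactC (<⇒≤ 2≤k) (s≤s k≤n) (≤-trans k≤n ν<M)
          i₂ , n≡ , C₂ = read-exact C sound exactC (s≤s z≤n) ≤-refl ν<M
          i , kn≡ = index (*-mono-≤ (<⇒≤ 2≤k) (s≤s z≤n)) kn≤M
          new≡ = cong₂ _+_ C₁ C₂
          kn≤new = begin
            ‖ suc (toℕ i) ‖              ≡⟨ cong ‖_‖ (sym kn≡) ⟩
            ‖ x * suc ν ‖                ≤⟨ ‖*‖-≤ (<⇒≤ 2≤k) (s≤s z≤n) ⟩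
            ‖ x ‖ + ‖ suc ν ‖            ≡⟨ new≡ ⟨
            lookup C i₁ + lookup C i₂    ∎
      in j , refl ,
      (put-then bd mul (≤-trans kn≤M M≤B) λ bd₁ →
       put-then bd₁ (read {i = i₁} k≡) (≤-trans (entries≤ bd i₁) w≤B) λ bd₂ →
       put-then bd₂ (read {i = i₂} n≡) (≤-trans (entries≤ bd i₂) w≤B) λ bd₃ →
       put-then bd₃ add (≤-trans (+-mono-≤ (entries≤ bd i₁) (entries≤ bd i₂)) 2w≤B) λ bd₄ →
       bind (improve-spec m _ i (λ ()) bd₄ kn≡ kn≤new sound)
       (byCells λ C′ bd₅ (keep , C′⊑C , sound′ , upper) →
         let k′≡ = trans (cong (_+ 1) (keep k (λ ()))) (+-comm x 1) in
         put bd₅ add (≤-trans (≤-reflexive k′≡) (≤-trans (s≤s (≤-trans k≤n ν<M)) 1+M≤B))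
           ( (keep N (λ ()) , keep n (λ ()) , (λ i → ≤-trans (C′⊑C i) (C⊑C₀ i)) , sound′)
           , keep kTop (λ ())
           , <-≤-trans K<k (≤-reflexive (trans (+-suc x j) (cong (_+ j) (sym k′≡))))
           , ≤-trans (m≤n⇒m≤1+n 2≤k) (≤-reflexive (sym k′≡))
           , λ {y} 2≤y y<k′ → [ (λ y<k → upper-⊑ C′ C (uppers 2≤y y<k) C′⊑C)
                              , (λ { refl k k≡ → ≤-trans (upper k (trans k≡ kn≡)) (≤-reflexive new≡) }) ]′
                              (m≤n⇒m<n∨m≡n (s≤s⁻¹ (≤-trans y<k′ (≤-reflexive k′≡)))) )))
      where open ≤-Reasoning

-- Fewer than n ones reach at most E(n - 1) = n - 1 in this range. It ends at 5 because E(5) = 6.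
n≤‖n‖ : ∀ {n} → 2 ≤ n → n ≤ 5 → n ≤ ‖ n ‖
n≤‖n‖ {suc n} 2≤n (s≤s n≤4) = ≮⇒≥ λ ‖n‖<n → <⇒≱
  (s≤s (≤-trans (E-mono-≤ (s≤s⁻¹ ‖n‖<n)) (≤-reflexive (E[n]≡n (s≤s⁻¹ 2≤n) n≤4)))) (n≤E[‖n‖] (<⇒≤ 2≤n))

-- Why step (3) may start at m = 6.
small-summand : ∀ {a b n} → 1 ≤ a → a ≤ 5 → 1 ≤ b → a + b ≡ suc n → suc ‖ n ‖ ≤ ‖ a ‖ + ‖ b ‖
small-summand {1}           {b} _ _   1≤b refl = +-monoˡ-≤ ‖ b ‖ (1≤‖‖ ≤-refl)
small-summand {suc (suc a)} {b} _ a≤5 1≤b refl = begin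
  suc ‖ suc a + b ‖          ≤⟨ s≤s (‖+‖-≤ {suc a} (s≤s z≤n) 1≤b) ⟩
  suc (‖ suc a ‖ + ‖ b ‖)    ≤⟨ +-monoˡ-≤ ‖ b ‖ (s≤s (‖‖≤n (s≤s z≤n))) ⟩
  suc (suc a) + ‖ b ‖        ≤⟨ +-monoˡ-≤ ‖ b ‖ (n≤‖n‖ (s≤s (s≤s z≤n)) a≤5) ⟩
  ‖ suc (suc a) ‖ + ‖ b ‖    ∎
  where open ≤-Reasoning

-- Exactness of new entries, initialisation and the complete run.

module Correctness (M l : ℕ) (1≤M : 1 ≤ M) (M<2^[1+l] : M < 2 ^ suc l) where

  open Specifications M l 1≤M M<2^[1+l]
  open Phases M l 1≤M M<2^[1+l]
  open MainLoop M l 1≤M M<2^[1+l]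

  -- `C₀` is the array before the iteration, `C` the one after step (3). Optimal sums are found by
  -- steps (1) and (3). Optimal products were offered earlier, because the larger factor of a
  -- product of factors at least 2 is smaller than the product.
  exact-next : ∀ C C₀ {ν K} → 1 ≤ ν → C ⊑ C₀ → Exact C₀ (suc ν) → Products C₀ (suc ν) →
               Upper C (suc ν) (suc ‖ ν ‖) → Cutoff ν K →
               (∀ {x} → 6 ≤ x → x ≤ K → Upper C (suc ν) (‖ x ‖ + ‖ suc ν ∸ x ‖)) → Exact C (suc (suc ν))
  exact-next C C₀ {ν} {K} 1≤ν C⊑C₀ exact products successor cutoff sums i i<2+ν
    with m≤n⇒m<n∨m≡n (s≤s⁻¹ i<2+ν)
  ... | inj₁ i<1+ν = ≤-trans (C⊑C₀ i) (exact i i<1+ν)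
  ... | inj₂ i≡1+ν = ≤-trans Ci≤ (≤-reflexive (cong ‖_‖ (sym i≡1+ν)))
    where
    open Cutoff cutoff
    -- The summands are ordered by complexity, not by size; this is what puts ‖a‖ in the lower half
    -- of T. If ‖n‖ > T, the entry left by step (1) is already optimal.
    summands : ∀ {a b} → 1 ≤ a → 1 ≤ b → a + b ≡ suc ν → ‖ a ‖ + ‖ b ‖ ≤ ‖ suc ν ‖ → ‖ a ‖ ≤ ‖ b ‖ → lookup C i ≤ ‖ suc ν ‖
    summands {a} {b} 1≤a 1≤b a+b≡ le a≤b with suc ‖ ν ‖ ≤? ‖ suc ν ‖
    ... | yes T<‖n‖ = ≤-trans (successor i i≡1+ν) T<‖n‖
    ... | no  T≮‖n‖ = ≤-trans (sums 6≤a a≤K i i≡1+ν) (≤-trans (≤-reflexive (cong (λ z → ‖ a ‖ + ‖ z ‖) (sym b≡))) le)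
      where
      b≡ : b ≡ suc ν ∸ a
      b≡ = trans (sym (m+n∸m≡n a b)) (cong (_∸ a) a+b≡)
      ab≤T : ‖ a ‖ + ‖ b ‖ ≤ ‖ ν ‖
      ab≤T = ≤-trans le (s≤s⁻¹ (≰⇒> T≮‖n‖))
      6≤a : 6 ≤ a
      6≤a = ≰⇒> λ a≤5 → T≮‖n‖ (≤-trans (small-summand 1≤a a≤5 1≤b a+b≡) le)
      ‖a‖≤cut : ‖ a ‖ ≤ cut
      ‖a‖≤cut = largest
        (≤-trans (+-monoʳ-≤ ‖ a ‖ (≤-trans (≤-reflexive (+-identityʳ ‖ a ‖)) a≤b)) ab≤T)
        (≤-trans (≤-reflexive (sym a+b≡)) (+-mono-≤ (n≤E[‖n‖] 1≤a)
          (≤-trans (n≤E[‖n‖] 1≤b) (E-mono-≤ (m+n≤o⇒m≤o∸n ‖ b ‖ (≤-trans (≤-reflexive (+-comm ‖ b ‖ ‖ a ‖)) ab≤T))))))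
      a≤K : a ≤ K
      a≤K = ≤-trans (n≤E[‖n‖] 1≤a) (≤-trans (E-mono-≤ ‖a‖≤cut) (≤-reflexive (sym K≡)))
    factors : ∀ {a b} → 2 ≤ a → 2 ≤ b → a * b ≡ suc ν → ‖ a ‖ + ‖ b ‖ ≤ ‖ suc ν ‖ → a ≤ b → lookup C i ≤ ‖ suc ν ‖
    factors {a} {b} 2≤a 2≤b ab≡ le a≤b =
      ≤-trans (C⊑C₀ i) (≤-trans (products 2≤a a≤b (<-≤-trans b<ab (≤-reflexive ab≡)) i (trans i≡1+ν (sym ab≡))) le)
      where
      b<ab : b < a * b
      b<ab = <-≤-trans (m<m*n b a {{>-nonZero (<⇒≤ 2≤b)}} 2≤a) (≤-reflexive (*-comm b a))
    Ci≤ : lookup C i ≤ ‖ suc ν ‖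
    Ci≤ with decompose (s≤s 1≤ν)
    ... | sum {a} {b} 1≤a 1≤b eq le with ≤-total ‖ a ‖ ‖ b ‖
    ...   | inj₁ a≤b = summands 1≤a 1≤b eq le a≤b
    ...   | inj₂ b≤a = summands 1≤b 1≤a (trans (+-comm b a) eq) (≤-trans (≤-reflexive (+-comm ‖ b ‖ ‖ a ‖)) le) b≤a
    Ci≤ | product {a} {b} 2≤a 2≤b eq le with ≤-total a b
    ...   | inj₁ a≤b = factors 2≤a 2≤b eq le a≤b
    ...   | inj₂ b≤a = factors 2≤b 2≤a (trans (*-comm b a) eq) (≤-trans (≤-reflexive (+-comm ‖ b ‖ ‖ a ‖)) le) b≤a

  iterationτ : ℕ → ℕ
  iterationτ ν = 6 + (step₂τ + ((2 + Σ< (2 * suc (φ ν)) (λ _ → 9)) + (step₄τ ν + 1)))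

  Loop : ℕ → State M → Set
  Loop k σ = ∃[ ν ] reg σ N ≡ M × reg σ n ≡ suc ν × 1 ≤ ν × ν + k ≡ M
           × Sound (compl σ) × Exact (compl σ) (suc ν) × Products (compl σ) (suc ν)

  -- Costs in `repeat` are indexed by the number j of iterations still to come; the one with j left
  -- treats n = ν + 1 with ν = M - (j + 1).
  iteration : ∀ {k} σ → Bounded σ → Loop k σ → Holds σ ($ n ≼ $ N) →
              ∃[ j ] k ≡ suc j × Triple (step₁ ⨟ step₂ ⨟ step₃ ⨟ step₄ ⨟ n ≔ $ n ⊕ # 1) σ (iterationτ (M ∸ suc j)) (Loop j)
  iteration {zero} σ bd (ν , N≡ , n≡ , _ , ν+k≡ , _) h = contradiction
    (≤-trans (≤-trans (≤-reflexive (sym n≡)) h) (≤-trans (≤-reflexive N≡) (≤-reflexive (trans (sym ν+k≡) (+-identityʳ ν))))) 1+n≰n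
  iteration {suc j} σ bd (ν , N≡ , n≡ , 1≤ν , ν+k≡ , sound , exact , products) h = j , refl ,
    subst (λ x → Triple (step₁ ⨟ step₂ ⨟ step₃ ⨟ step₄ ⨟ n ≔ $ n ⊕ # 1) σ (iterationτ x) (Loop j)) ν≡
    (bind (step₁-spec {compl σ} σ bd 1≤ν ν<M exact (N≡ , n≡ , (λ _ → ≤-refl) , sound))
     λ σ₁ bd₁ (stage₁@(_ , _ , C₁⊑C , sound₁) , successor) →
     bind (step₂-spec {compl σ} σ₁ bd₁ 1≤ν ν<M exact stage₁) λ σ₂ bd₂ (cutoff , N₂ , n₂ , C₂≡C₁) →
     let open Cutoff cutoff
         C₂ = compl σ₂
         K≤ν = ≤-trans (≤-reflexive K≡) (E[t]≤n {t = cut} 1≤ν 2cut≤T)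
         C₂⊑C = subst (_⊑ compl σ) (sym C₂≡C₁) C₁⊑C in
     bind (weaken (s≤s (s≤s (Σ<-monoˡ-≤ (λ _ → 9) (≤-trans (≤-reflexive K≡) (E[t]≤2[1+φ] {t = cut} 1≤ν 2cut≤T reachable)))))
       (step₃-spec {C₂} σ₂ bd₂ K≤ν ν<M (exact-⊑ C₂ (compl σ) exact C₂⊑C)
         (N₂ , n₂ , (λ _ → ≤-refl) , subst Sound (sym C₂≡C₁) sound₁)))
     λ σ₃ bd₃ ((N₃ , n₃ , C₃⊑C₂ , sound₃) , sums) →
     let C₃ = compl σ₃
         C₃⊑C₁ = subst (C₃ ⊑_) C₂≡C₁ C₃⊑C₂
         C₃⊑C : C₃ ⊑ compl σ
         C₃⊑C  = λ i → ≤-trans (C₃⊑C₁ i) (C₁⊑C i)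
         exact₃ = exact-next C₃ (compl σ) 1≤ν C₃⊑C exact products (upper-⊑ C₃ (compl σ₁) successor C₃⊑C₁) cutoff sums in
     bind (step₄-spec {C₃} σ₃ bd₃ 1≤ν ν<M exact₃ (N₃ , n₃ , (λ _ → ≤-refl) , sound₃))
     (byCells λ { C₄ bd₄ ((refl , refl , C₄⊑C₃ , sound₄) , multiples) →
       put bd₄ add (≤-trans (≤-reflexive (+-comm (suc ν) 1)) (≤-trans (s≤s ν<M) 1+M≤B))
         ( suc ν , refl , +-comm (suc ν) 1 , s≤s z≤n , trans (sym (+-suc ν j)) ν+k≡ , sound₄
         , exact-⊑ C₄ C₃ exact₃ C₄⊑C₃
         , λ {a} {b} 2≤a a≤b b<2+ν → [ (λ b<1+ν → upper-⊑ C₄ (compl σ) (products 2≤a a≤b b<1+ν) (λ i → ≤-trans (C₄⊑C₃ i) (C₃⊑C i)))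
                                     , (λ { refl → multiples 2≤a a≤b }) ]′ (m≤n⇒m<n∨m≡n (s≤s⁻¹ b<2+ν)) ) }))
    where
    ν<M : ν < M
    ν<M = ≤-trans (≤-reflexive (sym n≡)) (≤-trans h (≤-reflexive N≡))
    ν≡ : ν ≡ M ∸ suc j
    ν≡ = trans (sym (m+n∸n≡m ν (suc j))) (cong (_∸ suc j) ν+k≡)

  halvingτ : ℕ
  halvingτ = suc (Σ< w (λ _ → 3))

  initialiseτ : ℕ
  initialiseτ = 3 + (halvingτ + suc (suc (Σ< M (λ _ → 3)) + 1))

  -- Why the array may start at ⌊log₂ M³⌋ + 1: 2^‖n‖ ≤ n³ ≤ M³ < 2^b for n ≥ 2.
  ‖‖≤bound : ∀ {b} → 1 ≤ b → M * M * M < 2 ^ b → (i : Fin M) → ‖ suc (toℕ i) ‖ ≤ b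
  ‖‖≤bound {b} 1≤b M³<2^b i = helper (toℕ i) (toℕ<n i)
    where
    open ≤-Reasoning
    cube : ∀ x → x * (x * (x * 1)) ≡ x * x * x
    cube = solve-∀
    helper : ∀ x → x < M → ‖ suc x ‖ ≤ b
    helper zero    _   = ≤-trans ‖1‖≤1 1≤b
    helper (suc x) x<M = ≮⇒≥ λ b<‖n‖ → <⇒≱ M³<2^b (begin
      2 ^ b                      ≤⟨ ^-monoʳ-≤ 2 (<⇒≤ b<‖n‖) ⟩
      2 ^ ‖ suc (suc x) ‖        ≤⟨ 2^‖n‖≤n^3 (suc (suc x)) (s≤s (s≤s z≤n)) ⟩
      suc (suc x) ^ 3            ≤⟨ ^-monoˡ-≤ 3 x<M ⟩
      M ^ 3                      ≡⟨ cube M ⟩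
      M * M * M                  ∎)

  input-bounded : Bounded (input M)
  input-bounded = record { regs≤ = lookup-update-≤ (Vec.replicate 15 0) N zeros M≤B
                         ; entries≤ = λ i → ≤-trans (≤-reflexive (lookup-replicate i 0)) z≤n }
    where
    zeros : ∀ (r : Reg) → lookup (Vec.replicate 15 0) r ≤ B
    zeros r = ≤-trans (≤-reflexive (lookup-replicate r 0)) z≤n

  initialise-spec : Triple initialise (input M) initialiseτ
    (λ σ → reg σ N ≡ M × Sound (compl σ) × Exact (compl σ) 2)
  initialise-spec =
    put-then input-bounded mul M²≤B λ bd₁ →
    put-then bd₁ mul M³≤B λ bd₂ →
    put-then bd₂ copy 1≤B λ bd₃ →
    bind (weaken (s≤s (Σ<-monoˡ-≤ (λ _ → 3) (pred[n]≤n {w})))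
      (repeat Halving (λ _ → 2) halve (pred w) bd₃
        (refl , <-≤-trans M³<2^w (≤-reflexive (cong (2 ^_) (sym (suc-pred w {{w≢0}})))) , 0 , refl , suc-pred w {{w≢0}} , ≤-reflexive (sym (*-identityʳ _)))))
    (byCells λ { C bd₄ (¬h , k , refl , _ , p , refl , p+k≡ , X<) →
      let b≤w = ≤-trans (s≤s (m≤m+n p k)) (≤-reflexive p+k≡)
          X<2^b = <-≤-trans X< (*-monoˡ-≤ (2 ^ p) (s≤s (≮⇒≥ ¬h)))
      in
      put-then bd₄ copy 1≤B λ bd₅ →
      bind (repeat (Filling (suc p)) (λ _ → 2) (fill b≤w) M bd₅ (refl , refl , refl , s≤s z≤n , λ { i (s≤s ()) }))
      λ σ₆ bd₆ (¬h , _ , N≡ , _ , _ , _ , filled) →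
      let first , 1≡ = index ≤-refl 1≤M
          filled′ = λ i → filled i (≤-<-trans (toℕ<n i) (≤-<-trans (≤-reflexive (sym N≡)) (≰⇒> ¬h)))
          sound = λ i → ≤-trans (‖‖≤bound (s≤s z≤n) X<2^b i) (≤-reflexive (sym (filled′ i))) in
      store bd₆ first 1≡ (≤-trans (s≤s z≤n) 3≤w)
        ( N≡
        , (λ i → [ (λ i≡ → ≤-trans (≤-trans (≤-reflexive (cong (λ j → ‖ suc (toℕ j) ‖) i≡))
                             (≤-trans (≤-reflexive (cong ‖_‖ (sym 1≡))) ‖1‖≤1))
                             (≤-reflexive (sym (trans (cong (lookup (compl σ₆ [ first ]≔ 1)) i≡) (lookup∘update first (compl σ₆) 1)))))
                 , (λ i≢ → ≤-trans (sound i) (≤-reflexive (sym (lookup∘update′ i≢ (compl σ₆) 1)))) ]′ (equal? i first))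
        , λ i i<2 → let i≡ = toℕ-injective (≤-antisym (≤-trans (s≤s⁻¹ (s≤s⁻¹ i<2)) z≤n) (≤-trans (≤-reflexive (suc-injective (sym 1≡))) z≤n)) in
            ≤-trans (≤-reflexive (trans (cong (lookup (compl σ₆ [ first ]≔ 1)) i≡) (lookup∘update first (compl σ₆) 1))) (1≤‖‖ (s≤s z≤n)) ) })
    where
    w≢0 : NonZero w
    w≢0 = >-nonZero (≤-trans (s≤s z≤n) 3≤w)
    equal? : ∀ (i j : Fin M) → i ≡ j ⊎ i ≢ j
    equal? i j with i ≟ᶠ j
    ... | yes i≡j = inj₁ i≡j
    ... | no  i≢j = inj₂ i≢j
    -- After p halvings M³ < (m + 1) 2^p and bound = p + 1. The loop exits with m ≤ 1, which gives
    -- M³ < 2^bound, and p + k + 1 = w keeps bound ≤ w.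
    Halving : ℕ → State M → Set
    Halving k σ = reg σ N ≡ M × reg σ m < 2 ^ suc k
                × ∃[ p ] reg σ bound ≡ suc p × suc (p + k) ≡ w × M * M * M < suc (reg σ m) * 2 ^ p
    halve : ∀ {k} σ → Bounded σ → Halving k σ → Holds σ (# 1 ≺ $ m) →
            ∃[ j ] k ≡ suc j × Triple (m ≔ $ m ⊘ # 2 ⨟ bound ≔ $ bound ⊕ # 1) σ 2 (Halving j)
    halve {zero}  σ bd (_ , m<2 , _) h = contradiction m<2 (≤⇒≯ h)
    halve {suc j} (cells _ _ x _ _ _ _ _ _ _ _ _ _ _ _ _) bd (refl , m<2^ , p , refl , p+k≡ , X<) h = j , refl ,
      (put-then bd (quot refl) (≤-trans (m/n≤m x 2) (regs≤ bd m)) λ bd₁ →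
       put bd₁ add (≤-trans (≤-trans (≤-reflexive (+-comm (suc p) 1)) (≤-trans (s≤s (s≤s (m≤m+n p j))) (≤-reflexive p+j≡))) w≤B)
         ( refl
         , *-cancelʳ-< 2 (x / 2) (2 ^ suc j) (≤-<-trans (m/n*n≤m x 2) (<-≤-trans m<2^ (≤-reflexive (*-comm 2 (2 ^ suc j)))))
         , suc p , +-comm (suc p) 1 , p+j≡
         , <-≤-trans X< (≤-trans (*-monoˡ-≤ (2 ^ p) (m<[1+m/n]*n x 2)) (≤-reflexive (*-assoc (suc (x / 2)) 2 (2 ^ p)))) ))
      where
      p+j≡ : suc (suc (p + j)) ≡ w
      p+j≡ = trans (cong suc (sym (+-suc p j))) p+k≡
    Filling : ℕ → ℕ → State M → Set
    Filling b k σ = reg σ N ≡ M × reg σ bound ≡ b × reg σ n + k ≡ suc M × 1 ≤ reg σ n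
                  × (∀ i → suc (toℕ i) < reg σ n → lookup (compl σ) i ≡ b)
    fill : ∀ {b} → b ≤ w → ∀ {k} σ → Bounded σ → Filling b k σ → Holds σ ($ n ≼ $ N) →
           ∃[ j ] k ≡ suc j × Triple (Compl[ $ n ]≔ $ bound ⨟ n ≔ $ n ⊕ # 1) σ 2 (Filling b j)
    fill b≤w {zero} σ bd (N≡ , _ , n+k≡ , _) h = contradiction
      (≤-trans (≤-reflexive (trans (sym n+k≡) (+-identityʳ _))) (≤-trans h (≤-reflexive N≡))) 1+n≰n
    fill {b} b≤w {suc j} σ@(cells _ x _ _ _ _ _ _ _ _ _ _ _ _ _ C) bd (refl , refl , n+k≡ , 1≤n , filled) h =
      let i , n≡ = index 1≤n h in j , refl ,
      (bind (store {Q = _≡ setCompl i b σ} bd i n≡ b≤w refl) λ { _ bd₁ refl →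
       put bd₁ add (≤-trans (≤-reflexive (+-comm x 1)) (≤-trans (s≤s h) 1+M≤B))
         ( refl , refl , trans (+-assoc x 1 j) n+k≡ , ≤-trans 1≤n (m≤m+n x 1)
         , λ i′ i′<n → [ (λ i′≡i → trans (cong (lookup (C [ i ]≔ b)) i′≡i) (lookup∘update i C b))
                       , (λ i′≢i → trans (lookup∘update′ i′≢i C b)
                           (filled i′ (≤∧≢⇒< (s≤s⁻¹ (≤-trans i′<n (≤-reflexive (+-comm x 1))))
                             λ eq → i′≢i (toℕ-injective (suc-injective (trans eq n≡)))))) ]′ (equal? i′ i) ) })

  loopτ : ℕ
  loopτ = suc (Σ< (M ∸ 1) (λ j → suc (iterationτ (M ∸ suc j))))

  opaque

    timeImproved-spec : Triple timeImproved (input M) (initialiseτ + suc loopτ)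
      (λ σ → ∀ i → lookup (compl σ) i ≡ ‖ suc (toℕ i) ‖)
    timeImproved-spec =
      bind initialise-spec
      (byCells λ { C bd (refl , sound , exact) →
       put-then bd copy (≤-trans (s≤s (s≤s z≤n)) 6≤B) λ bd₁ →
       consequence
         (repeat Loop (λ j → iterationτ (M ∸ suc j)) iteration (M ∸ 1) bd₁
           (1 , refl , refl , ≤-refl , m+[n∸m]≡n 1≤M , sound , exact ,
            λ 2≤a a≤b b<2 → contradiction (≤-trans 2≤a a≤b) (<⇒≱ b<2)))
         λ σ (¬h , _ , ν , N≡ , n≡ , _ , _ , sound , exact , _) i →
           lookup-exact (compl σ) sound exact i
             (≤-<-trans (toℕ<n i) (≤-<-trans (≤-reflexive (sym N≡)) (<-≤-trans (≰⇒> ¬h) (≤-reflexive n≡)))) })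

-- Summation of the costs.

module Growth (M : ℕ) (1≤M : 1 ≤ M) where

  l : ℕ
  l = ⌊log₂ M ⌋

  open Specifications M l 1≤M (n<2^[1+⌊log₂n⌋] M) public
  open Phases M l 1≤M (n<2^[1+⌊log₂n⌋] M) public
  open MainLoop M l 1≤M (n<2^[1+⌊log₂n⌋] M) public
  open Correctness M l 1≤M (n<2^[1+⌊log₂n⌋] M) public

  w≡3L : w ≡ 3 * suc l
  w≡3L = trans w≡3+3l (sym (*-suc 3 l))

  private
    L = suc l
    C = proj₁ Σφ≤g

  step₂τ-≤ : step₂τ ≤ 450 * L ^ 2
  step₂τ-≤ = begin
    step₂τ                                       ≡⟨ cong (λ z → 3 + (evaluateτ + (suc z + Eτ))) (Σ<-const w _) ⟩
    stepsOf w                                      ≤⟨ quadratic w (≤-trans (s≤s z≤n) 3≤w) ⟩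
    50 * (w * w)                                 ≡⟨ cong (λ w → 50 * (w * w)) w≡3L ⟩
    50 * (3 * L * (3 * L))                       ≡⟨ expand₂ L ⟩
    450 * L ^ 2                                  ∎
    where
    open ≤-Reasoning
    evaluation : ℕ → ℕ
    evaluation w = suc ((5 + 3 * w) + ((5 + 3 * w) + 1))
    stepsOf : ℕ → ℕ
    stepsOf w = 3 + (evaluation w + (suc (w * suc (suc (evaluation w))) + (5 + 3 * w)))
    -- `stepsOf w` is 6 w² + 23 w + 21, and 50 is the sum of these coefficients. With w = a + 1 the
    -- added polynomial is the difference to 50 w².
    expand₁ : ∀ a → let w = suc a ; e = suc ((5 + 3 * w) + ((5 + 3 * w) + 1)) in
              3 + (e + (suc (w * suc (suc e)) + (5 + 3 * w))) + (44 * (a * a) + 65 * a) ≡ 50 * (w * w)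
    expand₁ = solve-∀
    quadratic : ∀ w → 1 ≤ w → stepsOf w ≤ 50 * (w * w)
    quadratic (suc a) _ = m+n≤o⇒m≤o (stepsOf (suc a)) (≤-reflexive (expand₁ a))
    expand₂ : ∀ L → 50 * (3 * L * (3 * L)) ≡ 450 * (L * (L * 1))
    expand₂ = solve-∀

  X : ℕ
  X = M * L ^ 2

  L≤L² : L ≤ L ^ 2
  L≤L² = m≤m*n L (L ^ 1)

  1≤L² : 1 ≤ L ^ 2
  1≤L² = ≤-trans (s≤s z≤n) L≤L²

  L²≤X : L ^ 2 ≤ X
  L²≤X = m≤n*m (L ^ 2) M {{>-nonZero 1≤M}}

  M≤X : M ≤ X
  M≤X = m≤m*n M (L ^ 2) {{>-nonZero 1≤L²}}

  -- A pass of step (3) or (4) costs 9. From kMax ≤ 2 (1 + φ) come 18 φ and 18 of the constant 33;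
  -- 483 is 33 + 450.
  iterationτ-≤ : ∀ ν → suc (iterationτ ν) ≤ 483 * L ^ 2 + (18 * φ ν + 9 * (M ÷ suc ν))
  iterationτ-≤ ν = begin
    suc (iterationτ ν)
      ≡⟨ cong₂ (λ x y → suc (6 + (step₂τ + ((2 + x) + (5 + y + 1))))) (Σ<-const (2 * suc (φ ν)) 9) (Σ<-const (M / suc ν) 9) ⟩
    suc (6 + (step₂τ + ((2 + 2 * suc (φ ν) * 9) + (5 + (M / suc ν) * 9 + 1))))
      ≡⟨ collect step₂τ (φ ν) (M / suc ν) ⟩
    (33 * 1 + step₂τ) + (18 * φ ν + 9 * (M ÷ suc ν))
      ≤⟨ +-monoˡ-≤ _ (+-mono-≤ (*-monoʳ-≤ 33 1≤L²) step₂τ-≤) ⟩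
    (33 * L ^ 2 + 450 * L ^ 2) + (18 * φ ν + 9 * (M ÷ suc ν))
      ≡⟨ cong (_+ (18 * φ ν + 9 * (M ÷ suc ν))) (*-distribʳ-+ (L ^ 2) 33 450) ⟨
    483 * L ^ 2 + (18 * φ ν + 9 * (M ÷ suc ν))
      ∎
    where
    open ≤-Reasoning
    collect : ∀ s p q → suc (6 + (s + ((2 + 2 * suc p * 9) + (5 + q * 9 + 1)))) ≡ (33 * 1 + s) + (18 * p + 9 * q)
    collect = solve-∀

  loopτ-≤ : loopτ ≤ suc (483 * X + (18 * (C * g M) + 9 * X))
  loopτ-≤ = s≤s (begin
    Σ< (M ∸ 1) (λ j → suc (iterationτ (M ∸ suc j)))
      -- One more term, the one for ν = 0, completes the range, so that reversing it turns the count
      -- of remaining iterations into ν.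
      ≤⟨ Σ<-monoˡ-≤ (λ j → suc (iterationτ (M ∸ suc j))) (m∸n≤m M 1) ⟩
    Σ< M (λ j → suc (iterationτ (M ∸ suc j)))
      ≡⟨ Σ<-reverse M (λ ν → suc (iterationτ ν)) ⟩
    Σ< M (λ ν → suc (iterationτ ν))
      ≤⟨ Σ<-mono-≤ M (λ {ν} _ → iterationτ-≤ ν) ⟩
    Σ< M (λ ν → 483 * L ^ 2 + (18 * φ ν + 9 * (M ÷ suc ν)))
      ≡⟨ trans (Σ<-+ M _ _) (cong₂ _+_ (Σ<-const M _) (trans (Σ<-+ M _ _) (cong₂ _+_ (Σ<-*ˡ M 18 φ) (Σ<-*ˡ M 9 (λ ν → M ÷ suc ν))))) ⟩
    M * (483 * L ^ 2) + (18 * Σ< M φ + 9 * Σ< M (λ ν → M ÷ suc ν))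
      -- Since M ÷ 0 = 0, the sum of M ÷ (ν + 1) over ν < M equals the harmonic sum from 0 to M.
      ≤⟨ +-mono-≤ (≤-reflexive (exchange M 483 (L ^ 2))) (+-mono-≤ (*-monoʳ-≤ 18 (≤-trans (Σ<-monoˡ-≤ φ (n≤1+n M)) (proj₂ Σφ≤g 1≤M)))
           (*-monoʳ-≤ 9 (≤-trans (≤-reflexive (sym (Σ<-split 1 M (M ÷_)))) (≤-trans (Σ÷-harmonic M L (n<2^[1+⌊log₂n⌋] M)) (*-monoʳ-≤ M L≤L²))))) ⟩
    483 * X + (18 * (C * g M) + 9 * X)
      ∎)
    where
    open ≤-Reasoning
    exchange : ∀ a b c → a * (b * c) ≡ b * (a * c)
    exchange = solve-∀

  initialiseτ-≤ : initialiseτ ≤ 19 * X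
  initialiseτ-≤ = begin
    3 + (suc (Σ< w (λ _ → 3)) + suc (suc (Σ< M (λ _ → 3)) + 1))
      ≡⟨ cong₂ (λ x y → 3 + (suc x + suc (suc y + 1))) (trans (Σ<-const w 3) (cong (_* 3) w≡3L)) (Σ<-const M 3) ⟩
    3 + (suc (3 * L * 3) + suc (suc (M * 3) + 1))
      ≡⟨ collect L M ⟩
    7 * 1 + (9 * L + 3 * M)
      ≤⟨ +-mono-≤ (*-monoʳ-≤ 7 (≤-trans 1≤M M≤X)) (+-mono-≤ (*-monoʳ-≤ 9 (≤-trans L≤L² L²≤X)) (*-monoʳ-≤ 3 M≤X)) ⟩
    7 * X + (9 * X + 3 * X)
      ≡⟨ sum-up X ⟩
    19 * X
      ∎
    where
    open ≤-Reasoning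
    collect : ∀ L M → 3 + (suc (3 * L * 3) + suc (suc (M * 3) + 1)) ≡ 7 * 1 + (9 * L + 3 * M)
    collect = solve-∀
    sum-up : ∀ X → 7 * X + (9 * X + 3 * X) ≡ 19 * X
    sum-up = solve-∀

  time-≤ : initialiseτ + suc loopτ ≤ (513 * 162 + 18 * C) * g M
  time-≤ = begin
    initialiseτ + suc loopτ                                          ≤⟨ +-mono-≤ initialiseτ-≤ (s≤s loopτ-≤) ⟩
    19 * X + suc (suc (483 * X + (18 * (C * g M) + 9 * X)))          ≡⟨ collect X (C * g M) ⟩
    2 * 1 + 511 * X + 18 * (C * g M)                                 ≤⟨ +-monoˡ-≤ (18 * (C * g M)) (+-monoˡ-≤ (511 * X) (*-monoʳ-≤ 2 (≤-trans 1≤M M≤X))) ⟩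
    2 * X + 511 * X + 18 * (C * g M)                                 ≡⟨ cong (_+ 18 * (C * g M)) (*-distribʳ-+ X 2 511) ⟨
    513 * X + 18 * (C * g M)                                         ≤⟨ +-monoˡ-≤ (18 * (C * g M)) (*-monoʳ-≤ 513 (MlogM²≤g 1≤M)) ⟩
    513 * (162 * g M) + 18 * (C * g M)                               ≡⟨ cong₂ _+_ (*-assoc 513 162 (g M)) (*-assoc 18 C (g M)) ⟨
    513 * 162 * g M + 18 * C * g M                                   ≡⟨ *-distribʳ-+ (g M) (513 * 162) (18 * C) ⟨
    (513 * 162 + 18 * C) * g M                                       ∎
    where
    open ≤-Reasoning
    collect : ∀ X G → 19 * X + suc (suc (483 * X + (18 * G + 9 * X))) ≡ 2 * 1 + 511 * X + 18 * G
    collect = solve-∀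

  bits-B : bits B ≡ 5 + 3 * l
  bits-B = trans (cong bits B≡2^[1+w]) (trans (cong suc (⌊log₂[2^n]⌋≡n (suc w))) (cong (2 +_) w≡3+3l))

  -- The array dominates, as `w` is O(log M). For M ≥ 4 the rounded iterated logarithm is at least 1
  -- and absorbs additive constants; 125 is 15 * 8 + 5.
  spaceBound-≤ : 4 ≤ M → spaceBound ≤ 125 * MloglogM M
  spaceBound-≤ 4≤M = begin
    15 * bits B + M * bits w
      ≤⟨ +-mono-≤ (*-monoʳ-≤ 15 bits-B-≤) (*-monoʳ-≤ M bits-w-≤) ⟩
    15 * (8 * (M * λ′)) + M * (5 * λ′)
      ≡⟨ collect M λ′ ⟩
    125 * (M * λ′)
      ∎
    where
    open ≤-Reasoning
    λ′ = ⌊log₂ l ⌋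
    collect : ∀ M x → 15 * (8 * (M * x)) + M * (5 * x) ≡ 125 * (M * x)
    collect = solve-∀
    2≤l : 2 ≤ l
    2≤l = ≤-trans (≤-reflexive (sym (⌊log₂[2^n]⌋≡n 2))) (⌊log₂⌋-mono-≤ 4≤M)
    1≤l = <⇒≤ 2≤l
    1≤λ : 1 ≤ λ′
    1≤λ = ≤-trans (≤-reflexive (sym (⌊log₂[2^n]⌋≡n 1))) (⌊log₂⌋-mono-≤ 2≤l)
    l≤M : l ≤ M
    l≤M = ≤-trans (<⇒≤ (n<2^n l)) (2^⌊log₂n⌋≤n M 1≤M)
    bits-B-≤ : bits B ≤ 8 * (M * λ′)
    bits-B-≤ = begin
      bits B           ≡⟨ bits-B ⟩
      5 * 1 + 3 * l    ≤⟨ +-monoˡ-≤ (3 * l) (*-monoʳ-≤ 5 1≤l) ⟩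
      5 * l + 3 * l    ≡⟨ *-distribʳ-+ l 5 3 ⟨
      8 * l            ≤⟨ *-monoʳ-≤ 8 (≤-trans l≤M (m≤m*n M λ′ {{>-nonZero 1≤λ}})) ⟩
      8 * (M * λ′)     ∎
    -- A power of two as the factor makes the logarithm of the bound exactly 3 + ⌊log₂ l⌋.
    w≤8l : w ≤ 2 * (2 * (2 * l))
    w≤8l = begin
      w                    ≡⟨ w≡3+3l ⟩
      3 * 1 + 3 * l        ≤⟨ +-monoˡ-≤ (3 * l) (*-monoʳ-≤ 3 1≤l) ⟩
      3 * l + 3 * l        ≤⟨ m≤m+n (3 * l + 3 * l) (2 * l) ⟩
      3 * l + 3 * l + 2 * l ≡⟨ octuple l ⟩
      2 * (2 * (2 * l))    ∎
      where
      octuple : ∀ l → 3 * l + 3 * l + 2 * l ≡ 2 * (2 * (2 * l))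
      octuple = solve-∀
    log-8l : ⌊log₂ 2 * (2 * (2 * l)) ⌋ ≡ 3 + λ′
    log-8l = trans (⌊log₂[2*b]⌋≡1+⌊log₂b⌋ (2 * (2 * l)) {{m*n≢0 2 (2 * l) {{_}} {{m*n≢0 2 l}}}})
      (cong suc (trans (⌊log₂[2*b]⌋≡1+⌊log₂b⌋ (2 * l) {{m*n≢0 2 l}}) (cong suc (⌊log₂[2*b]⌋≡1+⌊log₂b⌋ l))))
      where instance _ = >-nonZero 1≤l
    bits-w-≤ : bits w ≤ 5 * λ′
    bits-w-≤ = begin
      suc ⌊log₂ w ⌋                      ≤⟨ s≤s (⌊log₂⌋-mono-≤ w≤8l) ⟩
      suc ⌊log₂ 2 * (2 * (2 * l)) ⌋      ≡⟨ cong suc log-8l ⟩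
      4 * 1 + λ′                         ≤⟨ +-monoˡ-≤ λ′ (*-monoʳ-≤ 4 1≤λ) ⟩
      4 * λ′ + λ′                        ≡⟨ +-comm (4 * λ′) λ′ ⟩
      5 * λ′                             ∎

theorem13 : Σ[ run ∈ (∀ M → .{{_ : NonZero M}} → Run M) ]
    ( (∀ M .{{_ : NonZero M}} (i : Fin M) → ‖ suc (toℕ i) ‖≡ entry (run M) i)
    × ((λ M → time (run M)) ∈O[N^ 1230175 / 1000000 ])
    × ((λ M → peakSpace (run M)) ∈O[ MloglogM ]) )
theorem13 = run , correct , time-growth , space-growth
  where
  module G (M : ℕ) .{{M≢0 : NonZero M}} = Growth M (>-nonZero⁻¹ M)
  spec = λ M .{{M≢0 : NonZero M}} → G.timeImproved-spec M
  run : ∀ M → .{{_ : NonZero M}} → Run M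
  run M = record { execution = G.computation (spec M) }
  correct : ∀ M .{{_ : NonZero M}} (i : Fin M) → ‖ suc (toℕ i) ‖≡ entry (run M) i
  correct M i = subst (‖ suc (toℕ i) ‖≡_) (sym (G.post (spec M) i)) (‖‖-correct (toℕ i))
  time-growth : (λ M → time (run M)) ∈O[N^ 1230175 / 1000000 ]
  -- The comparison of exponents is 11 * 10^6 ≤ 9 * 1230175.
  time-growth = g-growth {1230175} {1000000} (λ M → time (run M)) (513 * 162 + 18 * proj₁ Σφ≤g) (≤ᵇ⇒≤ (11 * 1000000) (1230175 * 9) tt)
    λ M → ≤-trans (G.steps≤ (spec M)) (G.time-≤ M)
  space-growth : (λ M → peakSpace (run M)) ∈O[ MloglogM ]
  space-growth = 125 , 4 , λ M 4≤M → ≤-trans (G.peak≤ (spec M)) (G.spaceBound-≤ M 4≤M)
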